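{- Let $s,k\ge 2$ be integers and let $\mathcal H$ be a graph with vertex set $\{1,\dots,k\}$. For each positive integer $n$, let $X^1,\dots,X^k$ be lattice points chosen independently and uniformly at random from $\{1,\dots,n\}^s$. Then $$\lim_{n\to\infty}\mathbb P\big((X^1,\dots,X^k)\text{ is }\mathcal H\text{ -visible}\big)=\zeta_{\mathcal H}(s)^{ -1},\qquad\text{where } \zeta_{\mathcal H}(s)=\prod_p\left(\frac{P_{\mathcal H}(p^s)}{p^{ks}}\right)^{ -1},$$ the product running over all primes $p$, and $P_{\mathcal H}$ being the chromatic polynomial of $\mathcal H$.
   Context: Two distinct points $X,Y\in\mathbb Z^s$ are called mutually visible, written $X\diamond Y$, if the closed line segment joining them contains no lattice point of $\mathbb Z^s$ other than $X$ and $Y$ (so $X\diamond Y$ requires $X\ne Y$). Given a graph $\mathcal H$ on vertex set $\{1,\dots,k\}$, a sequence of lattice points $(X^1,\dots,X^k)$ is called $\mathcal H$-visible if $X^i\diamond X^j$ whenever $\{i,j\}$ is an edge of $\mathcal H$. The chromatic polynomial $P_{\mathcal H}(x)$ is the polynomial whose value at a positive integer $x$ is the number of proper colorings of the (labeled) vertices of $\mathcal H$ with $x$ colours, i.e. assignments of colours such that adjacent vertices receive different colours. The function $\zeta_{\mathcal H}$ is called the chromatic zeta function of $\mathcal H$. -}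

module Defs where

open import Data.Nat as ℕ using (ℕ; zero; suc; _^_; _∸_; _<_; _≤_; NonZero)
open import Data.Nat.Properties using (m^n≢0)
open import Data.Nat.Primality using (Prime; prime?)
open import Data.Integer as ℤ using (ℤ; +_)
open import Data.Rational as ℚ using (ℚ)
open import Data.Fin using (Fin; zero; suc)
open import Data.Fin.Properties using (all?) renaming (_≟_ to _≟ᶠ_)
open import Data.Bool using (Bool; true)
open import Data.List using (List; []; _∷_; [_]; map; concatMap; filter; length; allFin; upTo; foldr)
open import Data.Empty using (⊥)
open import Relation.Nullary using (¬_; Dec)
open import Relation.Nullary.Decidable using (_→-dec_)
open import Relation.Binary.PropositionalEquality using (_≡_)
open import Data.Bool.Properties using () renaming (_≟_ to _≟ᵇ_)

Point : ℕ → Set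
Point s = Fin s → ℤ

_≈ₚ_ : ∀ {s} → Point s → Point s → Set
X ≈ₚ Y = ∀ i → X i ≡ Y i

-- Z lies on the closed segment [X,Y] at parameter t = a/b (0 ≤ a ≤ b, b > 0):
-- b·Z = (b−a)·X + a·Y. Z is strictly between X and Y iff 0 < a < b.
-- Mutual visibility X ◇ Y: X ≠ Y and no lattice point of the segment other than X, Y.
-- (For X ≠ Y, a lattice point on the segment has rational parameter, so this is
-- exactly the paper's definition.)
_◇_ : ∀ {s} → Point s → Point s → Set
_◇_ {s} X Y =
  (¬ (X ≈ₚ Y)) ×'
  ((Z : Point s) (a b : ℕ) → 0 < a → a < b →
     ¬ (∀ i → (+ b) ℤ.* Z i ≡ (+ (b ∸ a)) ℤ.* X i ℤ.+ (+ a) ℤ.* Y i))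
  where
  open import Data.Product using () renaming (_×_ to _×'_)

record Graph (k : ℕ) : Set where
  field
    adj   : Fin k → Fin k → Bool
    sym   : ∀ i j → adj i j ≡ adj j i
    loopless : ∀ i → ¬ (adj i i ≡ true)
open Graph public

Visible : ∀ {s k} → Graph k → (Fin k → Point s) → Set
Visible H X = ∀ i j → adj H i j ≡ true → X i ◇ X j

allFuns : ∀ {A : Set} (k : ℕ) → List A → List (Fin k → A)
allFuns zero xs = [ (λ ()) ]
allFuns (suc k) xs =
  concatMap (λ a → map (λ f → λ { zero → a ; (suc i) → f i }) (allFuns k xs)) xs

box : (s n : ℕ) → List (Point s)
box s n = allFuns s (map (λ m → + suc m) (upTo n))

-- Number of H-visible k-tuples in ({1,…,n}^s)^k, counted with any decision
-- procedure for mutual visibility (the count does not depend on the choice).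
visibleCount : ∀ {s k} → (∀ (X Y : Point s) → Dec (X ◇ Y)) → Graph k → ℕ → ℕ
visibleCount {s} {k} dec H n =
  length (filter (λ X → all? (λ i → all? (λ j →
            (adj H i j ≟ᵇ true) →-dec dec (X i) (X j))))
          (allFuns k (box s n)))

visibleProb : ∀ {s k} → (∀ (X Y : Point s) → Dec (X ◇ Y)) → Graph k → ℕ → ℚ
visibleProb {s} {k} dec H n =
  ℚ._/_ (+ visibleCount dec H (suc n)) (suc n ^ (k ℕ.* s)) {{m^n≢0 (suc n) (k ℕ.* s)}}

Proper : ∀ {k x} → Graph k → (Fin k → Fin x) → Set
Proper H c = ∀ i j → adj H i j ≡ true → ¬ (c i ≡ c j)

chromatic : ∀ {k} → Graph k → ℕ → ℕ
chromatic {k} H x =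
  length (filter (λ c → all? (λ i → all? (λ j →
            (adj H i j ≟ᵇ true) →-dec Relation.Nullary.¬? (c i ≟ᶠ c j))))
          (allFuns k (allFin x)))
  where import Relation.Nullary

eulerFactor : ∀ {k} → Graph k → (s p : ℕ) → ℚ
eulerFactor {k} H s zero = ℚ.1ℚ
eulerFactor {k} H s (suc p) =
  ℚ._/_ (+ chromatic H (suc p ^ s)) (suc p ^ (k ℕ.* s)) {{m^n≢0 (suc p) (k ℕ.* s)}}

partialProduct : ∀ {k} → Graph k → (s M : ℕ) → ℚ
partialProduct H s M =
  foldr ℚ._*_ ℚ.1ℚ (map (eulerFactor H s) (filter prime? (upTo (suc M))))

-- Two lattice points are mutually visible iff no prime divides all their coordinate differences, so a tuple is
-- H-visible iff modulo every prime p its residues, read as p^s colours, properly colour H.  By the Chinese remainder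
-- theorem the tuples that pass this test for the primes p ≤ M have density exactly ∏_{p ≤ M} P_H(p^s)/p^{ks} in every
-- cube whose side is a multiple of the primorial of M, and nearly that density in every large cube.  Passing the test
-- for p ≤ M without being visible forces the two ends of some edge to be congruent modulo some d with M < d ≤ n; as
-- Σ_{d>M} d⁻² ≤ 1/M, such tuples have density O(1/M), uniformly in n.  The same bound, read off in a common multiple of
-- the two primorials, controls the tail of the Euler product.
module Submission where

-- The limit is in general irrational (for a single edge it is `1/ζ(s)`), so two rational sequences
-- are compared directly: one threshold serving `n` and `M` at once makes both sequences Cauchy with
-- a common limit. Every estimate is therefore explicit. Given `m` with `2/m < ε`, the cutoff for
-- the primes is `k² 2^s m`: there are at most `k²` ordered edges, and the tuples in which the ends
-- of a given edge agree modulo `d ≤ n` have proportion at most `2^s / d²`, because each coordinate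
-- contributes a factor `2/d` and `s ≥ 2` leaves at least a square. The moduli `d` range over all
-- integers above the cutoff, not only over primes, since coincident points have gcd 0 and must be
-- charged to some modulus. Counts stay in `ℕ` with denominators cleared, and subtractions are
-- replaced by adding a term to both sides. Tuples are functions, compared only pointwise, so the
-- summands are required to respect pointwise equality.

open import Defs hiding (sym)

-- Finite sums over lists, ranges and lists of functions.

module Summation where

  open import Data.Nat
  open import Data.Nat.Properties
  open import Data.Nat.Tactic.RingSolver using (solve-∀)
  open import Data.Bool using (true; false; if_then_else_)
  open import Data.Fin using (Fin; zero; suc; toℕ; combine; _↑ˡ_; _↑ʳ_; punchOut)
  open import Data.Fin.Properties as Finₚ using (any?; punchOut-injective; injective⇒≤)
  open import Data.Fin.Permutation using (Permutation′; permutation)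
  open import Data.List using (List; []; _∷_; _++_; map; concatMap; filter; length; allFin; upTo)
  open import Data.List.Properties using (map-tabulate; map-upTo)
  open import Data.Product using (_×_; _,_; proj₁; proj₂; ∃)
  open import Data.Vec.Functional using () renaming (_∷_ to _∷ᶠ_)
  open import Data.Unit using (⊤; tt)
  open import Function using (_∘_; id; Injective)
  open import Relation.Nullary using (Dec; yes; no; does; ¬_; contradiction)
  open import Relation.Unary using () renaming (Decidable to Decidable₁)
  open import Relation.Binary.PropositionalEquality
  open import Algebra.Properties.CommutativeMonoid.Sum +-0-commutativeMonoid using (sum-permute) renaming (sum to sumᶠ)

  private variable
    A B C : Set

  ∑ : List A → (A → ℕ) → ℕ
  ∑ []       f = 0
  ∑ (x ∷ xs) f = f x + ∑ xs f

  syntax ∑ xs (λ x → e) = ∑[ x ∈ xs ] e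

  ∑-cong : ∀ (xs : List A) {f g : A → ℕ} → (∀ x → f x ≡ g x) → ∑ xs f ≡ ∑ xs g
  ∑-cong []       eq = refl
  ∑-cong (x ∷ xs) eq = cong₂ _+_ (eq x) (∑-cong xs eq)

  ∑-mono : ∀ (xs : List A) {f g : A → ℕ} → (∀ x → f x ≤ g x) → ∑ xs f ≤ ∑ xs g
  ∑-mono []       le = z≤n
  ∑-mono (x ∷ xs) le = +-mono-≤ (le x) (∑-mono xs le)

  ∑-+ : ∀ (xs : List A) (f g : A → ℕ) → ∑[ x ∈ xs ] (f x + g x) ≡ ∑ xs f + ∑ xs g
  ∑-+ []       f g = refl
  ∑-+ (x ∷ xs) f g rewrite ∑-+ xs f g = interchange (f x) (g x) (∑ xs f) (∑ xs g)
    where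
    interchange : ∀ a b c d → a + b + (c + d) ≡ a + c + (b + d)
    interchange = solve-∀

  ∑-*ˡ : ∀ (xs : List A) c (f : A → ℕ) → ∑[ x ∈ xs ] (c * f x) ≡ c * ∑ xs f
  ∑-*ˡ []       c f = sym (*-zeroʳ c)
  ∑-*ˡ (x ∷ xs) c f rewrite ∑-*ˡ xs c f = sym (*-distribˡ-+ c (f x) (∑ xs f))

  ∑-*ʳ : ∀ (xs : List A) c (f : A → ℕ) → ∑[ x ∈ xs ] (f x * c) ≡ ∑ xs f * c
  ∑-*ʳ xs c f = trans (∑-cong xs (λ x → *-comm (f x) c)) (trans (∑-*ˡ xs c f) (*-comm c _))

  ∑-const : ∀ (xs : List A) c → ∑[ x ∈ xs ] c ≡ length xs * c
  ∑-const []       c = refl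
  ∑-const (x ∷ xs) c = cong (c +_) (∑-const xs c)

  ∑-swap : ∀ (xs : List A) (ys : List B) (f : A → B → ℕ) →
           ∑[ x ∈ xs ] ∑[ y ∈ ys ] f x y ≡ ∑[ y ∈ ys ] ∑[ x ∈ xs ] f x y
  ∑-swap []       ys f = sym (trans (∑-const ys 0) (*-zeroʳ (length ys)))
  ∑-swap (x ∷ xs) ys f rewrite ∑-swap xs ys f = sym (∑-+ ys (f x) _)

  ∑-++ : ∀ (xs ys : List A) f → ∑ (xs ++ ys) f ≡ ∑ xs f + ∑ ys f
  ∑-++ []       ys f = refl
  ∑-++ (x ∷ xs) ys f rewrite ∑-++ xs ys f = sym (+-assoc (f x) _ _)

  ∑-map : ∀ (φ : A → B) xs f → ∑ (map φ xs) f ≡ ∑ xs (f ∘ φ)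
  ∑-map φ []       f = refl
  ∑-map φ (x ∷ xs) f = cong (f (φ x) +_) (∑-map φ xs f)

  ∑-concatMap : ∀ (φ : A → List B) xs f → ∑ (concatMap φ xs) f ≡ ∑[ x ∈ xs ] ∑ (φ x) f
  ∑-concatMap φ []       f = refl
  ∑-concatMap φ (x ∷ xs) f = trans (∑-++ (φ x) _ f) (cong (_ +_) (∑-concatMap φ xs f))

  𝟙 : {P : Set} → Dec P → ℕ
  𝟙 P? = if does P? then 1 else 0

  𝟙-mono : {P Q : Set} (P? : Dec P) (Q? : Dec Q) → (P → Q) → 𝟙 P? ≤ 𝟙 Q?
  𝟙-mono (no  _) Q?      P⇒Q = z≤n
  𝟙-mono (yes p) (yes _) P⇒Q = ≤-refl
  𝟙-mono (yes p) (no ¬q) P⇒Q = contradiction (P⇒Q p) ¬q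

  𝟙-cong : {P Q : Set} (P? : Dec P) (Q? : Dec Q) → (P → Q) → (Q → P) → 𝟙 P? ≡ 𝟙 Q?
  𝟙-cong P? Q? P⇒Q Q⇒P = ≤-antisym (𝟙-mono P? Q? P⇒Q) (𝟙-mono Q? P? Q⇒P)

  𝟙≤1 : {P : Set} (P? : Dec P) → 𝟙 P? ≤ 1
  𝟙≤1 P? = 𝟙-mono P? (yes tt) (λ _ → tt)

  𝟙-true : {P : Set} (P? : Dec P) → P → 𝟙 P? ≡ 1
  𝟙-true P? p = 𝟙-cong P? (yes tt) (λ _ → tt) (λ _ → p)

  𝟙-false : {P : Set} (P? : Dec P) → ¬ P → 𝟙 P? ≡ 0
  𝟙-false (no _)  _  = refl
  𝟙-false (yes p) ¬p = contradiction p ¬p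

  length-filter-𝟙 : {P : A → Set} (P? : Decidable₁ P) (xs : List A) →
                  length (filter P? xs) ≡ ∑[ x ∈ xs ] 𝟙 (P? x)
  length-filter-𝟙 P? []       = refl
  length-filter-𝟙 P? (x ∷ xs) with does (P? x)
  ... | true  = cong suc (length-filter-𝟙 P? xs)
  ... | false = length-filter-𝟙 P? xs

  length≡∑1 : (xs : List A) → length xs ≡ ∑[ x ∈ xs ] 1
  length≡∑1 xs = sym (trans (∑-const xs 1) (*-identityʳ _))

  ∑-upTo-suc : ∀ n f → ∑ (upTo (suc n)) f ≡ f 0 + ∑ (upTo n) (f ∘ suc)
  ∑-upTo-suc n f = cong (f 0 +_) (trans (cong (λ xs → ∑ xs f) (sym (map-upTo suc n))) (∑-map suc (upTo n) f))

  ∑-upTo-+ : ∀ m n f → ∑ (upTo (m + n)) f ≡ ∑ (upTo m) f + ∑ (upTo n) (f ∘ (m +_))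
  ∑-upTo-+ zero    n f = refl
  ∑-upTo-+ (suc m) n f = begin
    ∑ (upTo (suc m + n)) f                                    ≡⟨ ∑-upTo-suc (m + n) f ⟩
    f 0 + ∑ (upTo (m + n)) (f ∘ suc)                          ≡⟨ cong (f 0 +_) (∑-upTo-+ m n (f ∘ suc)) ⟩
    f 0 + (∑ (upTo m) (f ∘ suc) + ∑ (upTo n) (f ∘ (suc m +_))) ≡⟨ +-assoc (f 0) _ _ ⟨
    f 0 + ∑ (upTo m) (f ∘ suc) + ∑ (upTo n) (f ∘ (suc m +_))   ≡⟨ cong₂ _+_ (∑-upTo-suc m f) refl ⟨
    ∑ (upTo (suc m)) f + ∑ (upTo n) (f ∘ (suc m +_))           ∎
    where open ≡-Reasoning

  ∑-upTo-cong : ∀ n {f g : ℕ → ℕ} → (∀ x → x < n → f x ≡ g x) → ∑ (upTo n) f ≡ ∑ (upTo n) g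
  ∑-upTo-cong zero    eq = refl
  ∑-upTo-cong (suc n) {f} {g} eq = begin
    ∑ (upTo (suc n)) f           ≡⟨ ∑-upTo-suc n f ⟩
    f 0 + ∑ (upTo n) (f ∘ suc)   ≡⟨ cong₂ _+_ (eq 0 z<s) (∑-upTo-cong n (λ x x<n → eq (suc x) (s<s x<n))) ⟩
    g 0 + ∑ (upTo n) (g ∘ suc)   ≡⟨ ∑-upTo-suc n g ⟨
    ∑ (upTo (suc n)) g           ∎
    where open ≡-Reasoning

  ∑-upTo-mono : ∀ {m n} → m ≤ n → ∀ f → ∑ (upTo m) f ≤ ∑ (upTo n) f
  ∑-upTo-mono {m} {n} m≤n f = begin
    ∑ (upTo m) f                                   ≤⟨ m≤m+n _ _ ⟩
    ∑ (upTo m) f + ∑ (upTo (n ∸ m)) (f ∘ (m +_))   ≡⟨ ∑-upTo-+ m (n ∸ m) f ⟨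
    ∑ (upTo (m + (n ∸ m))) f                       ≡⟨ cong (λ k → ∑ (upTo k) f) (m+[n∸m]≡n m≤n) ⟩
    ∑ (upTo n) f                                   ∎
    where open ≤-Reasoning

  ∑-upTo-* : ∀ m n f → ∑ (upTo (m * n)) f ≡ ∑[ t ∈ upTo m ] ∑[ y ∈ upTo n ] f (t * n + y)
  ∑-upTo-* zero    n f = refl
  ∑-upTo-* (suc m) n f = begin
    ∑ (upTo (n + m * n)) f
      ≡⟨ ∑-upTo-+ n (m * n) f ⟩
    ∑ (upTo n) f + ∑ (upTo (m * n)) (f ∘ (n +_))
      ≡⟨ cong (∑ (upTo n) f +_) (∑-upTo-* m n (f ∘ (n +_))) ⟩
    ∑ (upTo n) f + ∑[ t ∈ upTo m ] ∑[ y ∈ upTo n ] f (n + (t * n + y))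
      ≡⟨ cong (∑ (upTo n) f +_) (∑-cong (upTo m) (λ t → ∑-cong (upTo n) (λ y → cong f (sym (+-assoc n (t * n) y))))) ⟩
    ∑ (upTo n) f + ∑[ t ∈ upTo m ] ∑[ y ∈ upTo n ] f (suc t * n + y)
      ≡⟨ ∑-upTo-suc m (λ t → ∑[ y ∈ upTo n ] f (t * n + y)) ⟨
    ∑[ t ∈ upTo (suc m) ] ∑[ y ∈ upTo n ] f (t * n + y) ∎
    where open ≡-Reasoning

  ∑-allFin-suc : ∀ n (f : Fin (suc n) → ℕ) → ∑ (allFin (suc n)) f ≡ f zero + ∑ (allFin n) (f ∘ suc)
  ∑-allFin-suc n f = cong (f zero +_) (trans (cong (λ xs → ∑ xs f) (sym (map-tabulate id suc))) (∑-map suc (allFin n) f))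

  ∑-upTo≡∑-allFin : ∀ n f → ∑ (upTo n) f ≡ ∑ (allFin n) (f ∘ toℕ)
  ∑-upTo≡∑-allFin zero    f = refl
  ∑-upTo≡∑-allFin (suc n) f = trans (∑-upTo-suc n f)
    (trans (cong (f 0 +_) (∑-upTo≡∑-allFin n (f ∘ suc))) (sym (∑-allFin-suc n (f ∘ toℕ))))

  ∑-allFin-+ : ∀ m n (f : Fin (m + n) → ℕ) →
               ∑ (allFin (m + n)) f ≡ ∑[ i ∈ allFin m ] f (i ↑ˡ n) + ∑[ j ∈ allFin n ] f (m ↑ʳ j)
  ∑-allFin-+ zero    n f = refl
  ∑-allFin-+ (suc m) n f = begin
    ∑ (allFin (suc m + n)) f                        ≡⟨ ∑-allFin-suc (m + n) f ⟩
    f zero + ∑ (allFin (m + n)) (f ∘ suc)           ≡⟨ cong (f zero +_) (∑-allFin-+ m n (f ∘ suc)) ⟩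
    f zero + (∑[ i ∈ allFin m ] f (suc (i ↑ˡ n)) + ∑[ j ∈ allFin n ] f (suc (m ↑ʳ j))) ≡⟨ +-assoc (f zero) _ _ ⟨
    f zero + ∑[ i ∈ allFin m ] f (suc (i ↑ˡ n)) + ∑[ j ∈ allFin n ] f (suc (m ↑ʳ j))   ≡⟨ cong₂ _+_ (∑-allFin-suc m (λ i → f (i ↑ˡ n))) refl ⟨
    ∑[ i ∈ allFin (suc m) ] f (i ↑ˡ n) + ∑[ j ∈ allFin n ] f (suc m ↑ʳ j)              ∎
    where open ≡-Reasoning

  ∑-allFin-* : ∀ m n (f : Fin (m * n) → ℕ) →
               ∑ (allFin (m * n)) f ≡ ∑[ i ∈ allFin m ] ∑[ j ∈ allFin n ] f (combine i j)
  ∑-allFin-* zero    n f = refl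
  ∑-allFin-* (suc m) n f = begin
    ∑ (allFin (n + m * n)) f
      ≡⟨ ∑-allFin-+ n (m * n) f ⟩
    ∑[ j ∈ allFin n ] f (j ↑ˡ (m * n)) + ∑[ i ∈ allFin (m * n) ] f (n ↑ʳ i)
      ≡⟨ cong₂ _+_ refl (∑-allFin-* m n (f ∘ (n ↑ʳ_))) ⟩
    ∑[ j ∈ allFin n ] f (j ↑ˡ (m * n)) + ∑[ i ∈ allFin m ] ∑[ j ∈ allFin n ] f (n ↑ʳ combine i j)
      ≡⟨ ∑-allFin-suc m (λ i → ∑[ j ∈ allFin n ] f (combine i j)) ⟨
    ∑[ i ∈ allFin (suc m) ] ∑[ j ∈ allFin n ] f (combine i j) ∎
    where open ≡-Reasoning

  ∑-allFin≡sum : ∀ n (f : Fin n → ℕ) → ∑ (allFin n) f ≡ sumᶠ f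
  ∑-allFin≡sum zero    f = refl
  ∑-allFin≡sum (suc n) f = trans (∑-allFin-suc n f) (cong (f zero +_) (∑-allFin≡sum n (f ∘ suc)))

  -- A missed value could be punched out of the codomain, which would inject `Fin (suc n)` into
  -- `Fin n`.
  injective⇒surjective : ∀ {n} (σ : Fin n → Fin n) → Injective _≡_ _≡_ σ → ∀ y → ∃ λ x → σ x ≡ y
  injective⇒surjective {suc n} σ σ-inj y with any? (λ x → σ x Finₚ.≟ y)
  ... | yes hit = hit
  ... | no miss = contradiction (injective⇒≤ {f = λ x → punchOut {i = y} (y≢σ x)} λ {x} {x′} eq →
                    σ-inj (punchOut-injective (y≢σ x) (y≢σ x′) eq)) 1+n≰n
    where
    y≢σ : ∀ x → y ≢ σ x
    y≢σ x eq = miss (x , sym eq)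

  ∑-allFin-injective : ∀ {n} (σ : Fin n → Fin n) → Injective _≡_ _≡_ σ → ∀ f →
                       ∑ (allFin n) (f ∘ σ) ≡ ∑ (allFin n) f
  ∑-allFin-injective {n} σ σ-inj f = begin
    ∑ (allFin n) (f ∘ σ) ≡⟨ ∑-allFin≡sum n (f ∘ σ) ⟩
    sumᶠ (f ∘ σ)         ≡⟨ sum-permute f π ⟨
    sumᶠ f               ≡⟨ ∑-allFin≡sum n f ⟨
    ∑ (allFin n) f       ∎
    where
    open ≡-Reasoning
    σ⁻¹ = λ y → proj₁ (injective⇒surjective σ σ-inj y)
    σσ⁻¹ = λ y → proj₂ (injective⇒surjective σ σ-inj y)
    π : Permutation′ n
    π = permutation σ σ⁻¹ σσ⁻¹ (λ x → σ-inj (σσ⁻¹ (σ x)))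

  Pointwise : ∀ {m} → (A → A → Set) → (Fin m → A) → (Fin m → A) → Set
  Pointwise R f g = ∀ i → R (f i) (g i)

  -- Reindexing an enumeration of functions reproduces its entries only up to pointwise equality;
  -- this is the invariance that lets a summand survive such a change.
  Respects : (A → A → Set) → (A → ℕ) → Set
  Respects R h = ∀ {x y} → R x y → h x ≡ h y

  Respects₂ : (B → B → Set) → (C → C → Set) → (B → C → ℕ) → Set
  Respects₂ R S h = ∀ {b b′ c c′} → R b b′ → S c c′ → h b c ≡ h b′ c′

  ∷ᶠ-cong : ∀ {m} {R : A → A → Set} {a b} {f g : Fin m → A} →
            R a b → Pointwise R f g → Pointwise R (a ∷ᶠ f) (b ∷ᶠ g)
  ∷ᶠ-cong r rs zero    = r
  ∷ᶠ-cong r rs (suc i) = rs i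

  -- The entries of `allFuns` are pattern-matching lambdas, which agree with `a ∷ᶠ f` pointwise but
  -- not definitionally; hence the condition on `h`.
  ∑-allFuns : ∀ m (xs : List A) h → Respects (Pointwise _≡_) h →
              ∑ (allFuns (suc m) xs) h ≡ ∑[ a ∈ xs ] ∑[ f ∈ allFuns m xs ] h (a ∷ᶠ f)
  ∑-allFuns m xs h h-resp = trans (∑-concatMap _ xs h) (∑-cong xs λ a → trans (∑-map _ (allFuns m xs) h)
    (∑-cong (allFuns m xs) λ f → h-resp λ { zero → refl ; (suc i) → refl }))

  length-allFuns : ∀ m (xs : List A) → length (allFuns m xs) ≡ length xs ^ m
  length-allFuns zero    xs = refl
  length-allFuns (suc m) xs = begin
    length (allFuns (suc m) xs)              ≡⟨ length≡∑1 (allFuns (suc m) xs) ⟩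
    ∑[ f ∈ allFuns (suc m) xs ] 1            ≡⟨ ∑-allFuns m xs (λ _ → 1) (λ _ → refl) ⟩
    ∑[ a ∈ xs ] ∑[ f ∈ allFuns m xs ] 1      ≡⟨ ∑-cong xs (λ a → sym (length≡∑1 (allFuns m xs))) ⟩
    ∑[ a ∈ xs ] length (allFuns m xs)        ≡⟨ ∑-const xs _ ⟩
    length xs * length (allFuns m xs)        ≡⟨ cong (length xs *_) (length-allFuns m xs) ⟩
    length xs ^ suc m                        ∎
    where open ≡-Reasoning

  ≡⇒Pointwise : ∀ {R : A → A → Set} → (∀ {a} → R a a) → ∀ {m} {f g : Fin m → A} → (∀ i → f i ≡ g i) → Pointwise R f g
  ≡⇒Pointwise {R = R} R-refl {f = f} eq i = subst (R (f i)) (eq i) R-refl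

  -- The tail is enlarged with the head fixed, and then the head. The hypothesis must hold for every
  -- respectful summand because the summand seen by the head is itself a sum over tails.
  ∑-allFuns-mono : ∀ {R : A → A → Set} → (∀ {a} → R a a) → (xs ys : List A) → (∀ h → Respects R h → ∑ xs h ≤ ∑ ys h) →
                   ∀ m h → Respects (Pointwise R) h → ∑ (allFuns m xs) h ≤ ∑ (allFuns m ys) h
  ∑-allFuns-mono R-refl xs ys xs≤ys zero    h h-resp = ≤-refl
  ∑-allFuns-mono {R = R} R-refl xs ys xs≤ys (suc m) h h-resp = begin
    ∑ (allFuns (suc m) xs) h                        ≡⟨ ∑-allFuns m xs h (λ eq → h-resp (≡⇒Pointwise {R = R} R-refl eq)) ⟩
    ∑[ a ∈ xs ] ∑[ f ∈ allFuns m xs ] h (a ∷ᶠ f)    ≤⟨ ∑-mono xs (λ a → ∑-allFuns-mono R-refl xs ys xs≤ys m (h ∘ (a ∷ᶠ_))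
                                                         (λ rs → h-resp (∷ᶠ-cong {R = R} R-refl rs))) ⟩
    ∑[ a ∈ xs ] ∑[ f ∈ allFuns m ys ] h (a ∷ᶠ f)    ≤⟨ xs≤ys _ (λ r → ∑-cong (allFuns m ys)
                                                         (λ f → h-resp (∷ᶠ-cong {R = R} r (λ _ → R-refl)))) ⟩
    ∑[ a ∈ ys ] ∑[ f ∈ allFuns m ys ] h (a ∷ᶠ f)    ≡⟨ ∑-allFuns m ys h (λ eq → h-resp (≡⇒Pointwise {R = R} R-refl eq)) ⟨
    ∑ (allFuns (suc m) ys) h                        ∎
    where open ≤-Reasoning

  -- The image of xs under a ↦ (φ a , ψ a) covers every pair of ys × zs with multiplicity w.
  Covers : (B → B → Set) → (C → C → Set) → List A → (A → B) → (A → C) → ℕ → List B → List C → Set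
  Covers R S xs φ ψ w ys zs = ∀ h → Respects₂ R S h →
    ∑[ a ∈ xs ] h (φ a) (ψ a) ≡ w * ∑[ b ∈ ys ] ∑[ c ∈ zs ] h b c

  -- Entries of a tuple vary independently, so the multiplicities multiply. Used twice in
  -- succession, this carries a statement about one residue to the coordinates of a point and to the
  -- points of a tuple.
  Covers-allFuns : ∀ {R : B → B → Set} {S : C → C → Set} → (∀ {b} → R b b) → (∀ {c} → S c c) →
    ∀ {xs : List A} {φ ψ w ys zs} → Covers R S xs φ ψ w ys zs → ∀ m →
    Covers (Pointwise R) (Pointwise S) (allFuns m xs) (φ ∘_) (ψ ∘_) (w ^ m) (allFuns m ys) (allFuns m zs)
  Covers-allFuns {R = R} {S} R-refl S-refl {xs} {φ} {ψ} {w} {ys} {zs} cov zero h h-resp =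
    trans (cong (_+ 0) (h-resp (λ ()) (λ ()))) (sym (trans (+-identityʳ _) (+-identityʳ _)))
  Covers-allFuns {R = R} {S} R-refl S-refl {xs} {φ} {ψ} {w} {ys} {zs} cov (suc m) h h-resp = begin
    ∑[ f ∈ allFuns (suc m) xs ] h (φ ∘ f) (ψ ∘ f)
      ≡⟨ ∑-allFuns m xs _ (λ {f} {g} f≡g → h-resp (λ i → subst (λ y → R (φ (f i)) (φ y)) (f≡g i) R-refl)
                                                 (λ i → subst (λ y → S (ψ (f i)) (ψ y)) (f≡g i) S-refl)) ⟩
    ∑[ a ∈ xs ] ∑[ f ∈ allFuns m xs ] h (φ ∘ (a ∷ᶠ f)) (ψ ∘ (a ∷ᶠ f))
      ≡⟨ ∑-cong xs (λ a → ∑-cong (allFuns m xs) (λ f → h-resp (λ { zero → R-refl ; (suc i) → R-refl })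
                                                           (λ { zero → S-refl ; (suc i) → S-refl }))) ⟩
    ∑[ a ∈ xs ] ∑[ f ∈ allFuns m xs ] h (φ a ∷ᶠ φ ∘ f) (ψ a ∷ᶠ ψ ∘ f)
      ≡⟨ ∑-cong xs (λ a → Covers-allFuns R-refl S-refl {xs} {φ} {ψ} {w} {ys} {zs} cov m (λ f g → h (φ a ∷ᶠ f) (ψ a ∷ᶠ g))
                            (λ r s → h-resp (∷ᶠ-cong {R = R} R-refl r) (∷ᶠ-cong {R = S} S-refl s))) ⟩
    ∑[ a ∈ xs ] (w ^ m * inner (φ a) (ψ a))
      ≡⟨ ∑-*ˡ xs (w ^ m) _ ⟩
    w ^ m * ∑[ a ∈ xs ] inner (φ a) (ψ a)
      ≡⟨ cong (w ^ m *_) (cov inner inner-resp) ⟩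
    w ^ m * (w * ∑[ b ∈ ys ] ∑[ c ∈ zs ] inner b c)
      ≡⟨ trans (sym (*-assoc (w ^ m) w _)) (cong₂ _*_ (*-comm (w ^ m) w) refl) ⟩
    w ^ suc m * ∑[ b ∈ ys ] ∑[ c ∈ zs ] inner b c
      -- Moves the head sum over `zs` past the tail sum over `allFuns m ys`, so that head and tail
      -- of each family become adjacent.
      ≡⟨ cong (w ^ suc m *_) (∑-cong ys (λ b → ∑-swap zs (allFuns m ys) _)) ⟩
    w ^ suc m * ∑[ b ∈ ys ] ∑[ f ∈ allFuns m ys ] ∑[ c ∈ zs ] ∑[ g ∈ allFuns m zs ] h (b ∷ᶠ f) (c ∷ᶠ g)
      ≡⟨ cong (w ^ suc m *_) (∑-cong ys (λ b → ∑-cong (allFuns m ys) (λ f →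
           ∑-allFuns m zs (h (b ∷ᶠ f)) (λ eq → h-resp (λ _ → R-refl) (≡⇒Pointwise {R = S} S-refl eq))))) ⟨
    w ^ suc m * ∑[ b ∈ ys ] ∑[ f ∈ allFuns m ys ] ∑[ g ∈ allFuns (suc m) zs ] h (b ∷ᶠ f) g
      ≡⟨ cong (w ^ suc m *_) (∑-allFuns m ys (λ f → ∑[ g ∈ allFuns (suc m) zs ] h f g)
           (λ eq → ∑-cong (allFuns (suc m) zs) (λ g → h-resp (≡⇒Pointwise {R = R} R-refl eq) (λ _ → S-refl)))) ⟨
    w ^ suc m * ∑[ f ∈ allFuns (suc m) ys ] ∑[ g ∈ allFuns (suc m) zs ] h f g ∎
    where
    open ≡-Reasoning
    inner : _ → _ → ℕ
    inner b c = ∑[ f ∈ allFuns m ys ] ∑[ g ∈ allFuns m zs ] h (b ∷ᶠ f) (c ∷ᶠ g)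
    inner-resp : Respects₂ R S inner
    inner-resp r s = ∑-cong (allFuns m ys) λ f → ∑-cong (allFuns m zs) λ g →
      h-resp (∷ᶠ-cong {R = R} r (λ _ → R-refl)) (∷ᶠ-cong {R = S} s (λ _ → S-refl))

  Covers₁ : (B → B → Set) → List A → (A → B) → ℕ → List B → Set
  Covers₁ R xs φ w ys = ∀ h → Respects R h → ∑ xs (h ∘ φ) ≡ w * ∑ ys h

  -- The special case of `Covers-allFuns` in which the second component runs over a one-point list,
  -- whose tuples number `1 ^ m = 1`.
  Covers₁-allFuns : ∀ {R : B → B → Set} → (∀ {b} → R b b) → ∀ {xs : List A} {φ w ys} → Covers₁ R xs φ w ys →
    ∀ m → Covers₁ (Pointwise R) (allFuns m xs) (φ ∘_) (w ^ m) (allFuns m ys)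
  Covers₁-allFuns {R = R} R-refl {xs} {φ} {w} {ys} cov m h h-resp =
    trans (Covers-allFuns {S = λ _ _ → ⊤} R-refl tt {xs} {φ} {λ _ → tt} {w} {ys} {tt ∷ []} cov₂ m (λ f _ → h f) (λ r _ → h-resp r))
      (cong (w ^ m *_) (∑-cong (allFuns m ys) (λ f → trans (∑-const (allFuns m (tt ∷ [])) (h f))
        (trans (cong (_* h f) (trans (length-allFuns m (tt ∷ [])) (^-zeroˡ m))) (+-identityʳ _)))))
    where
    cov₂ : Covers R (λ _ _ → ⊤) xs φ (λ _ → tt) w ys (tt ∷ [])
    cov₂ k k-resp = trans (cov (λ b → k b tt) (λ r → k-resp r tt)) (cong (w *_) (∑-cong ys (λ b → sym (+-identityʳ _))))

-- Residues, the Chinese remainder theorem, and counts of congruent pairs.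

module Congruences where

  open Summation
  open import Data.Nat
  open import Data.Nat.Properties
  open import Data.Nat.DivMod
  open import Data.Nat.Divisibility
  open import Data.Nat.Primality using (Prime; euclidsLemma)
  open import Data.Nat.Tactic.RingSolver using (solve-∀)
  open import Data.Fin using (Fin; zero; suc; toℕ; fromℕ<)
  open import Data.Fin.Properties using (toℕ<n; toℕ-fromℕ<; toℕ-injective; all?)
  open import Data.List using (List; length; allFin; upTo)
  open import Data.List.Properties using (length-upTo)
  open import Data.Product using (_,_)
  open import Data.Sum using (inj₁; inj₂)
  open import Data.Vec.Functional using () renaming (_∷_ to _∷ᶠ_)
  open import Function using (_∘_; flip)
  open import Relation.Nullary using (Dec; yes; no; ¬_; contradiction)
  open import Relation.Nullary.Decidable using (_×-dec_)
  open import Relation.Unary using (Pred) renaming (Decidable to Decidable₁)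
  open import Relation.Binary.PropositionalEquality

  private variable
    A : Set

  ∣∸⇒%≡ : ∀ d .{{_ : NonZero d}} {x y} → x ≤ y → d ∣ y ∸ x → y % d ≡ x % d
  ∣∸⇒%≡ d {x} {y} x≤y (divides q eq) = begin
    y % d             ≡⟨ cong (_% d) (m+[n∸m]≡n x≤y) ⟨
    (x + (y ∸ x)) % d ≡⟨ cong (λ e → (x + e) % d) eq ⟩
    (x + q * d) % d   ≡⟨ [m+kn]%n≡m%n x q d ⟩
    x % d             ∎
    where open ≡-Reasoning

  ∣-∣⇒%≡ : ∀ d .{{_ : NonZero d}} x y → d ∣ ∣ x - y ∣ → x % d ≡ y % d
  ∣-∣⇒%≡ d x y d∣ with ≤-total x y
  ... | inj₁ x≤y = sym (∣∸⇒%≡ d x≤y (subst (d ∣_) (m≤n⇒∣m-n∣≡n∸m x≤y) d∣))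
  ... | inj₂ y≤x = ∣∸⇒%≡ d y≤x (subst (d ∣_) (m≤n⇒∣n-m∣≡n∸m y≤x) d∣)

  %≡⇒∣-∣ : ∀ d .{{_ : NonZero d}} x y → x % d ≡ y % d → d ∣ ∣ x - y ∣
  %≡⇒∣-∣ d x y eq = divides ∣ x / d - y / d ∣ (begin
    ∣ x - y ∣                                       ≡⟨ cong₂ ∣_-_∣ (m≡m%n+[m/n]*n x d) (m≡m%n+[m/n]*n y d) ⟩
    ∣ x % d + x / d * d - y % d + y / d * d ∣       ≡⟨ cong (λ r → ∣ x % d + x / d * d - r + y / d * d ∣) eq ⟨
    ∣ x % d + x / d * d - x % d + y / d * d ∣       ≡⟨ ∣m+n-m+o∣≡∣n-o∣ (x % d) _ _ ⟩
    ∣ x / d * d - y / d * d ∣                       ≡⟨ *-distribʳ-∣-∣ d (x / d) (y / d) ⟨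
    ∣ x / d - y / d ∣ * d                           ∎)
    where open ≡-Reasoning

  residue : ∀ p .{{_ : NonZero p}} → ℕ → Fin p
  residue p x = fromℕ< (m%n<n x p)

  toℕ-residue : ∀ p .{{_ : NonZero p}} x → toℕ (residue p x) ≡ x % p
  toℕ-residue p x = toℕ-fromℕ< (m%n<n x p)

  residue≡⇒∣-∣ : ∀ p .{{_ : NonZero p}} x y → residue p x ≡ residue p y → p ∣ ∣ x - y ∣
  residue≡⇒∣-∣ p x y eq = %≡⇒∣-∣ p x y (trans (sym (toℕ-residue p x)) (trans (cong toℕ eq) (toℕ-residue p y)))

  ∣-∣⇒residue≡ : ∀ p .{{_ : NonZero p}} x y → p ∣ ∣ x - y ∣ → residue p x ≡ residue p y
  ∣-∣⇒residue≡ p x y p∣ = toℕ-injective (trans (toℕ-residue p x) (trans (∣-∣⇒%≡ p x y p∣) (sym (toℕ-residue p y))))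

  ∣-∣-%⁺ : ∀ {d} Q .{{_ : NonZero d}} .{{_ : NonZero Q}} → d ∣ Q → ∀ x y → d ∣ ∣ x - y ∣ → d ∣ ∣ x % Q - y % Q ∣
  ∣-∣-%⁺ {d} Q d∣Q x y d∣ = %≡⇒∣-∣ d _ _ (trans (m∣n⇒o%n%m≡o%m d Q x d∣Q)
    (trans (∣-∣⇒%≡ d x y d∣) (sym (m∣n⇒o%n%m≡o%m d Q y d∣Q))))

  ∣-∣-%⁻ : ∀ {d} Q .{{_ : NonZero d}} .{{_ : NonZero Q}} → d ∣ Q → ∀ x y → d ∣ ∣ x % Q - y % Q ∣ → d ∣ ∣ x - y ∣
  ∣-∣-%⁻ {d} Q d∣Q x y d∣ = %≡⇒∣-∣ d _ _ (trans (sym (m∣n⇒o%n%m≡o%m d Q x d∣Q))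
    (trans (∣-∣⇒%≡ d _ _ d∣) (m∣n⇒o%n%m≡o%m d Q y d∣Q)))

  [tQ+y]%Q≡y : ∀ t Q .{{_ : NonZero Q}} {y} → y < Q → (t * Q + y) % Q ≡ y
  [tQ+y]%Q≡y t Q {y} y<Q = trans (cong (_% Q) (+-comm (t * Q) y)) (trans ([m+kn]%n≡m%n y t Q) (m<n⇒m%n≡m y<Q))

  Covers-% : ∀ t Q .{{_ : NonZero Q}} → Covers₁ _≡_ (upTo (t * Q)) (_% Q) t (upTo Q)
  Covers-% t Q h _ = begin
    ∑ (upTo (t * Q)) (h ∘ (_% Q))                           ≡⟨ ∑-upTo-* t Q _ ⟩
    ∑[ i ∈ upTo t ] ∑[ y ∈ upTo Q ] h ((i * Q + y) % Q)      ≡⟨ ∑-cong (upTo t) (λ i → ∑-upTo-cong Q (λ y y<Q → cong h ([tQ+y]%Q≡y i Q y<Q))) ⟩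
    ∑[ i ∈ upTo t ] ∑ (upTo Q) h                            ≡⟨ ∑-const (upTo t) _ ⟩
    length (upTo t) * ∑ (upTo Q) h                          ≡⟨ cong (_* ∑ (upTo Q) h) (length-upTo t) ⟩
    t * ∑ (upTo Q) h                                        ∎
    where open ≡-Reasoning

  -- Write `x = t * Q + y`. For fixed `y` the map from `t` to the residue of `x` modulo `p` is
  -- injective on `Fin p`, since `p` is a prime not dividing `Q`, hence it permutes `Fin p` and may
  -- be dropped from the sum.
  Covers-CRT : ∀ {p} Q .{{_ : NonZero p}} .{{_ : NonZero Q}} → Prime p → ¬ p ∣ Q →
               Covers _≡_ _≡_ (upTo (p * Q)) (residue p) (_% Q) 1 (allFin p) (upTo Q)
  Covers-CRT {p} Q p-prime p∤Q h _ = begin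
    ∑[ x ∈ upTo (p * Q) ] h (residue p x) (x % Q)
      ≡⟨ ∑-upTo-* p Q _ ⟩
    ∑[ t ∈ upTo p ] ∑[ y ∈ upTo Q ] h (residue p (t * Q + y)) ((t * Q + y) % Q)
      ≡⟨ ∑-cong (upTo p) (λ t → ∑-upTo-cong Q (λ y y<Q → cong (h _) ([tQ+y]%Q≡y t Q y<Q))) ⟩
    ∑[ t ∈ upTo p ] ∑[ y ∈ upTo Q ] h (residue p (t * Q + y)) y
      ≡⟨ ∑-upTo≡∑-allFin p _ ⟩
    ∑[ t ∈ allFin p ] ∑[ y ∈ upTo Q ] h (σ y t) y
      ≡⟨ ∑-swap (allFin p) (upTo Q) _ ⟩
    ∑[ y ∈ upTo Q ] ∑[ t ∈ allFin p ] h (σ y t) y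
      ≡⟨ ∑-cong (upTo Q) (λ y → ∑-allFin-injective (σ y) (σ-injective y) (λ z → h z y)) ⟩
    ∑[ y ∈ upTo Q ] ∑[ z ∈ allFin p ] h z y
      ≡⟨ ∑-swap (upTo Q) (allFin p) _ ⟩
    ∑[ z ∈ allFin p ] ∑[ y ∈ upTo Q ] h z y
      ≡⟨ *-identityˡ _ ⟨
    1 * ∑[ z ∈ allFin p ] ∑[ y ∈ upTo Q ] h z y ∎
    where
    open ≡-Reasoning
    σ : ℕ → Fin p → Fin p
    σ y t = residue p (toℕ t * Q + y)
    σ-injective : ∀ y {t t′} → σ y t ≡ σ y t′ → t ≡ t′
    -- The common `y` cancels, leaving `p` as a divisor of the distance of `t` and `t′` times `Q`.
    σ-injective y {t} {t′} eq with euclidsLemma ∣ toℕ t - toℕ t′ ∣ Q p-prime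
      (subst (p ∣_) (trans (trans (cong₂ ∣_-_∣ (+-comm (toℕ t * Q) y) (+-comm (toℕ t′ * Q) y))
          (∣m+n-m+o∣≡∣n-o∣ y _ _)) (sym (*-distribʳ-∣-∣ Q (toℕ t) (toℕ t′))))
        (residue≡⇒∣-∣ p (toℕ t * Q + y) (toℕ t′ * Q + y) eq))
    ... | inj₂ p∣Q = contradiction p∣Q p∤Q
    ... | inj₁ p∣  = toℕ-injective (trans (sym (m<n⇒m%n≡m (toℕ<n t)))
                       (trans (∣-∣⇒%≡ p _ _ p∣) (m<n⇒m%n≡m (toℕ<n t′))))

  𝟙-× : {P Q : Set} (P? : Dec P) (Q? : Dec Q) → 𝟙 (P? ×-dec Q?) ≡ 𝟙 P? * 𝟙 Q?
  𝟙-× (yes _) (yes _) = refl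
  𝟙-× (yes _) (no _)  = refl
  𝟙-× (no _)  Q?      = refl

  𝟙-all-suc : ∀ {m} {P : Pred (Fin (suc m)) _} (P? : Decidable₁ P) →
              𝟙 (all? P?) ≡ 𝟙 (P? zero) * 𝟙 (all? (P? ∘ suc))
  𝟙-all-suc P? = trans (𝟙-cong (all? P?) (P? zero ×-dec all? (P? ∘ suc)) (λ ∀P → ∀P zero , ∀P ∘ suc)
    (λ { (P₀ , Pₛ) zero → P₀ ; (P₀ , Pₛ) (suc i) → Pₛ i })) (𝟙-× (P? zero) (all? (P? ∘ suc)))

  ∑-upTo-𝟙≟ : ∀ a n → ∑[ y ∈ upTo n ] 𝟙 (a ≟ y) ≤ 1
  ∑-upTo-𝟙≟ a       zero    = z≤n
  ∑-upTo-𝟙≟ zero    (suc n) = ≤-reflexive (trans (∑-upTo-suc n (λ y → 𝟙 (0 ≟ y)))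
    (cong suc (trans (∑-const (upTo n) 0) (*-zeroʳ (length (upTo n))))))
  ∑-upTo-𝟙≟ (suc a) (suc n) = ≤-trans (≤-reflexive (∑-upTo-suc n (λ y → 𝟙 (suc a ≟ y))))
    (≤-trans (≤-reflexive (∑-cong (upTo n) (λ y → 𝟙-cong (suc a ≟ suc y) (a ≟ y) suc-injective (cong suc)))) (∑-upTo-𝟙≟ a n))

  congruentPairs : ℕ → ℕ → ℕ
  congruentPairs d n = ∑[ x ∈ upTo n ] ∑[ y ∈ upTo n ] 𝟙 (d ∣? ∣ x - y ∣)

  -- Round `n` up to `t * d`, that is, to `t` full periods with at most one solution in each. Then
  -- `d * t ≤ d + n`, and `d ≤ n` turns this into `2n`, the origin of every factor 2 in the later
  -- bounds.
  congruent-count : ∀ d n .{{_ : NonZero d}} → d ≤ n → ∀ x → d * ∑[ y ∈ upTo n ] 𝟙 (d ∣? ∣ x - y ∣) ≤ n + n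
  congruent-count d n d≤n x = begin
    d * ∑[ y ∈ upTo n ] 𝟙 (d ∣? ∣ x - y ∣)          ≤⟨ *-monoʳ-≤ d (∑-upTo-mono n≤td _) ⟩
    d * ∑[ y ∈ upTo (t * d) ] 𝟙 (d ∣? ∣ x - y ∣)    ≡⟨ cong (d *_) (∑-cong (upTo (t * d)) (λ y → 𝟙-cong (d ∣? _) (x % d ≟ y % d) (∣-∣⇒%≡ d x y) (%≡⇒∣-∣ d x y))) ⟩
    d * ∑[ y ∈ upTo (t * d) ] 𝟙 (x % d ≟ y % d)     ≡⟨ cong (d *_) (Covers-% t d (λ y → 𝟙 (x % d ≟ y)) (λ { refl → refl })) ⟩
    d * (t * ∑[ y ∈ upTo d ] 𝟙 (x % d ≟ y))         ≤⟨ *-monoʳ-≤ d (*-monoʳ-≤ t (∑-upTo-𝟙≟ (x % d) d)) ⟩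
    d * (t * 1)                                     ≡⟨ trans (cong (d *_) (*-identityʳ t)) (*-comm d t) ⟩
    d + n / d * d                                   ≤⟨ +-mono-≤ d≤n (m/n*n≤m n d) ⟩
    n + n                                           ∎
    where
    open ≤-Reasoning
    t : ℕ
    t = suc (n / d)
    n≤td : n ≤ t * d
    n≤td = begin
      n                 ≡⟨ m≡m%n+[m/n]*n n d ⟩
      n % d + n / d * d ≤⟨ +-monoˡ-≤ (n / d * d) (m%n≤n n d) ⟩
      t * d             ∎

  congruentPairs-bound : ∀ d n .{{_ : NonZero d}} → d ≤ n → d * congruentPairs d n ≤ 2 * (n * n)
  congruentPairs-bound d n d≤n = begin
    d * congruentPairs d n                                        ≡⟨ ∑-*ˡ (upTo n) d _ ⟨
    ∑[ x ∈ upTo n ] (d * ∑[ y ∈ upTo n ] 𝟙 (d ∣? ∣ x - y ∣))      ≤⟨ ∑-mono (upTo n) (congruent-count d n d≤n) ⟩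
    ∑[ x ∈ upTo n ] (n + n)                                       ≡⟨ ∑-const (upTo n) (n + n) ⟩
    length (upTo n) * (n + n)                                     ≡⟨ cong (_* (n + n)) (length-upTo n) ⟩
    n * (n + n)                                                   ≡⟨ double n ⟩
    2 * (n * n)                                                   ∎
    where
    open ≤-Reasoning
    double : ∀ n → n * (n + n) ≡ 2 * (n * n)
    double = solve-∀

  Congruent : ∀ {s} → ℕ → (Fin s → ℕ) → (Fin s → ℕ) → Set
  Congruent d x y = ∀ c → d ∣ ∣ x c - y c ∣

  congruent? : ∀ {s} d (x y : Fin s → ℕ) → Dec (Congruent d x y)
  congruent? d x y = all? (λ c → d ∣? ∣ x c - y c ∣)

  Congruent-resp : ∀ {s d} {x x′ y y′ : Fin s → ℕ} → (∀ c → x c ≡ x′ c) → (∀ c → y c ≡ y′ c) →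
                   Congruent d x y → Congruent d x′ y′
  Congruent-resp {d = d} x≡x′ y≡y′ x~y c = subst (d ∣_) (cong₂ ∣_-_∣ (x≡x′ c) (y≡y′ c)) (x~y c)

  𝟙-congruent-resp : ∀ {s} d {x x′ y y′ : Fin s → ℕ} → (∀ c → x c ≡ x′ c) → (∀ c → y c ≡ y′ c) →
                     𝟙 (congruent? d x y) ≡ 𝟙 (congruent? d x′ y′)
  𝟙-congruent-resp d {x} {x′} {y} {y′} x≡x′ y≡y′ = 𝟙-cong (congruent? d x y) (congruent? d x′ y′)
    (Congruent-resp x≡x′ y≡y′) (Congruent-resp (sym ∘ x≡x′) (sym ∘ y≡y′))

  cube : ∀ s → ℕ → List (Fin s → ℕ)
  cube s n = allFuns s (upTo n)

  length-cube : ∀ s n → length (cube s n) ≡ n ^ s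
  length-cube s n = trans (length-allFuns s (upTo n)) (cong (_^ s) (length-upTo n))

  -- Congruence of points is a conjunction over coordinates, so its indicator is a product and the
  -- double sum splits into `s` equal factors.
  ∑-congruent-cube : ∀ s d n → ∑[ x ∈ cube s n ] ∑[ y ∈ cube s n ] 𝟙 (congruent? d x y) ≡ congruentPairs d n ^ s
  ∑-congruent-cube zero    d n = refl
  ∑-congruent-cube (suc s) d n = begin
    ∑[ x ∈ cube (suc s) n ] ∑[ y ∈ cube (suc s) n ] 𝟙 (congruent? d x y)
      ≡⟨ ∑-allFuns s (upTo n) _ (λ eq → ∑-cong (cube (suc s) n) (λ y → 𝟙-congruent-resp d {y = y} {y} eq (λ _ → refl))) ⟩
    ∑[ a ∈ upTo n ] ∑[ x ∈ cube s n ] ∑[ y ∈ cube (suc s) n ] 𝟙 (congruent? d (a ∷ᶠ x) y)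
      ≡⟨ ∑-cong (upTo n) (λ a → ∑-cong (cube s n) (λ x → ∑-allFuns s (upTo n) _ (λ eq → 𝟙-congruent-resp d {a ∷ᶠ x} {a ∷ᶠ x} (λ _ → refl) eq))) ⟩
    ∑[ a ∈ upTo n ] ∑[ x ∈ cube s n ] ∑[ b ∈ upTo n ] ∑[ y ∈ cube s n ] 𝟙 (congruent? d (a ∷ᶠ x) (b ∷ᶠ y))
      ≡⟨ ∑-cong (upTo n) (λ a → ∑-cong (cube s n) (λ x → ∑-cong (upTo n) (λ b → trans
           (∑-cong (cube s n) (λ y → 𝟙-all-suc (λ c → d ∣? ∣ (a ∷ᶠ x) c - (b ∷ᶠ y) c ∣)))
           (∑-*ˡ (cube s n) (𝟙 (d ∣? ∣ a - b ∣)) _)))) ⟩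
    ∑[ a ∈ upTo n ] ∑[ x ∈ cube s n ] ∑[ b ∈ upTo n ] (𝟙 (d ∣? ∣ a - b ∣) * ∑[ y ∈ cube s n ] 𝟙 (congruent? d x y))
      ≡⟨ ∑-cong (upTo n) (λ a → trans (∑-cong (cube s n) (λ x → ∑-*ʳ (upTo n) _ (λ b → 𝟙 (d ∣? ∣ a - b ∣))))
           (∑-*ˡ (cube s n) (∑[ b ∈ upTo n ] 𝟙 (d ∣? ∣ a - b ∣)) _)) ⟩
    ∑[ a ∈ upTo n ] (∑[ b ∈ upTo n ] 𝟙 (d ∣? ∣ a - b ∣) * ∑[ x ∈ cube s n ] ∑[ y ∈ cube s n ] 𝟙 (congruent? d x y))
      ≡⟨ ∑-*ʳ (upTo n) _ _ ⟩
    congruentPairs d n * ∑[ x ∈ cube s n ] ∑[ y ∈ cube s n ] 𝟙 (congruent? d x y)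
      ≡⟨ cong (congruentPairs d n *_) (∑-congruent-cube s d n) ⟩
    congruentPairs d n ^ suc s ∎
    where open ≡-Reasoning

  -- Fixing one entry leaves `m - 1` free ones; the extra factor `length xs` on the left avoids the
  -- exponent `m - 1`. For two entries, `∑-marginal₂` carries two such factors.
  ∑-marginal₁ : ∀ m (xs : List A) (i : Fin m) (g : A → ℕ) →
                length xs * ∑[ f ∈ allFuns m xs ] g (f i) ≡ length xs ^ m * ∑ xs g
  ∑-marginal₁ (suc m) xs zero g = begin
    length xs * ∑[ f ∈ allFuns (suc m) xs ] g (f zero)   ≡⟨ cong (length xs *_) (∑-allFuns m xs _ (λ eq → cong g (eq zero))) ⟩
    length xs * ∑[ a ∈ xs ] ∑[ f ∈ allFuns m xs ] g a    ≡⟨ cong (length xs *_) (∑-cong xs (λ a →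
                                                              trans (∑-const (allFuns m xs) (g a)) (cong (_* g a) (length-allFuns m xs)))) ⟩
    length xs * ∑[ a ∈ xs ] (length xs ^ m * g a)        ≡⟨ cong (length xs *_) (∑-*ˡ xs (length xs ^ m) g) ⟩
    length xs * (length xs ^ m * ∑ xs g)                 ≡⟨ *-assoc (length xs) _ _ ⟨
    length xs ^ suc m * ∑ xs g                           ∎
    where open ≡-Reasoning
  ∑-marginal₁ (suc m) xs (suc i) g = begin
    length xs * ∑[ f ∈ allFuns (suc m) xs ] g (f (suc i))    ≡⟨ cong (length xs *_) (∑-allFuns m xs _ (λ eq → cong g (eq (suc i)))) ⟩
    length xs * ∑[ a ∈ xs ] ∑[ f ∈ allFuns m xs ] g (f i)    ≡⟨ cong (length xs *_) (∑-const xs _) ⟩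
    length xs * (length xs * ∑[ f ∈ allFuns m xs ] g (f i))  ≡⟨ cong (length xs *_) (∑-marginal₁ m xs i g) ⟩
    length xs * (length xs ^ m * ∑ xs g)                     ≡⟨ *-assoc (length xs) _ _ ⟨
    length xs ^ suc m * ∑ xs g                               ∎
    where open ≡-Reasoning

  ∑-marginal₂ : ∀ m (xs : List A) (i j : Fin m) → i ≢ j → (g : A → A → ℕ) →
                length xs * (length xs * ∑[ f ∈ allFuns m xs ] g (f i) (f j)) ≡ length xs ^ m * ∑[ a ∈ xs ] ∑[ b ∈ xs ] g a b
  ∑-marginal₂ (suc m) xs zero zero i≢j g = contradiction refl i≢j
  ∑-marginal₂ (suc m) xs zero (suc j) i≢j g = begin
    length xs * (length xs * ∑[ f ∈ allFuns (suc m) xs ] g (f zero) (f (suc j)))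
      ≡⟨ cong (λ z → length xs * (length xs * z)) (∑-allFuns m xs _ (λ eq → cong₂ g (eq zero) (eq (suc j)))) ⟩
    length xs * (length xs * ∑[ a ∈ xs ] ∑[ f ∈ allFuns m xs ] g a (f j))
      ≡⟨ cong (length xs *_) (∑-*ˡ xs (length xs) _) ⟨
    length xs * ∑[ a ∈ xs ] (length xs * ∑[ f ∈ allFuns m xs ] g a (f j))
      ≡⟨ cong (length xs *_) (∑-cong xs (λ a → ∑-marginal₁ m xs j (g a))) ⟩
    length xs * ∑[ a ∈ xs ] (length xs ^ m * ∑ xs (g a))
      ≡⟨ cong (length xs *_) (∑-*ˡ xs (length xs ^ m) _) ⟩
    length xs * (length xs ^ m * ∑[ a ∈ xs ] ∑[ b ∈ xs ] g a b)
      ≡⟨ *-assoc (length xs) _ _ ⟨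
    length xs ^ suc m * ∑[ a ∈ xs ] ∑[ b ∈ xs ] g a b ∎
    where open ≡-Reasoning
  -- Reduced to the previous clause by exchanging the two arguments of `g`.
  ∑-marginal₂ (suc m) xs (suc i) zero i≢j g =
    trans (∑-marginal₂ (suc m) xs zero (suc i) (λ ()) (flip g)) (cong (length xs ^ suc m *_) (∑-swap xs xs (flip g)))
  ∑-marginal₂ (suc m) xs (suc i) (suc j) i≢j g = begin
    length xs * (length xs * ∑[ f ∈ allFuns (suc m) xs ] g (f (suc i)) (f (suc j)))
      ≡⟨ cong (λ z → length xs * (length xs * z)) (∑-allFuns m xs _ (λ eq → cong₂ g (eq (suc i)) (eq (suc j)))) ⟩
    length xs * (length xs * ∑[ a ∈ xs ] ∑[ f ∈ allFuns m xs ] g (f i) (f j))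
      ≡⟨ cong (λ z → length xs * (length xs * z)) (∑-const xs _) ⟩
    length xs * (length xs * (length xs * ∑[ f ∈ allFuns m xs ] g (f i) (f j)))
      ≡⟨ cong (length xs *_) (∑-marginal₂ m xs i j (i≢j ∘ cong suc) g) ⟩
    length xs * (length xs ^ m * ∑[ a ∈ xs ] ∑[ b ∈ xs ] g a b)
      ≡⟨ *-assoc (length xs) _ _ ⟨
    length xs ^ suc m * ∑[ a ∈ xs ] ∑[ b ∈ xs ] g a b ∎
    where open ≡-Reasoning

  ^-distribʳ-* : ∀ s a b → (a * b) ^ s ≡ a ^ s * b ^ s
  ^-distribʳ-* zero    a b = refl
  ^-distribʳ-* (suc s) a b rewrite ^-distribʳ-* s a b = interchange a b (a ^ s) (b ^ s)
    where
    interchange : ∀ a b c d → a * b * (c * d) ≡ a * c * (b * d)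
    interchange = solve-∀

  -- Each coordinate has at most `2n²/d` congruent pairs, so a fraction `(2/d)^s` of all pairs of
  -- points is congruent; `s ≥ 2` allows `d ^ s` to be weakened to the summable `d * d`.
  ∑-congruent-bound : ∀ {s k} → 2 ≤ s → ∀ {n d} .{{_ : NonZero d}} → d ≤ n → {i j : Fin k} → i ≢ j →
    d * d * ∑[ x ∈ allFuns k (cube s n) ] 𝟙 (congruent? d (x i) (x j)) ≤ 2 ^ s * (n ^ s) ^ k
  ∑-congruent-bound {s} {k} 2≤s {n} {d} d≤n {i} {j} i≢j =
    -- The factor `L * L` comes from `∑-marginal₂`; it is nonzero because `0 < d ≤ n`.
    *-cancelˡ-≤ (L * L) {{m*n≢0 L L}} (begin
    L * L * (d * d * T)                  ≤⟨ *-monoʳ-≤ (L * L) (*-monoˡ-≤ T d²≤dˢ) ⟩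
    L * L * (d ^ s * T)                  ≡⟨ rearrange L (d ^ s) T ⟩
    d ^ s * (L * (L * T))                ≡⟨ cong (d ^ s *_) marginal ⟩
    d ^ s * (L ^ k * e ^ s)              ≡⟨ swap (d ^ s) (L ^ k) (e ^ s) ⟩
    L ^ k * (d ^ s * e ^ s)              ≡⟨ cong (L ^ k *_) (^-distribʳ-* s d e) ⟨
    L ^ k * (d * e) ^ s                  ≤⟨ *-monoʳ-≤ (L ^ k) (^-monoˡ-≤ s (congruentPairs-bound d n d≤n)) ⟩
    L ^ k * (2 * (n * n)) ^ s            ≡⟨ cong (L ^ k *_) (trans (^-distribʳ-* s 2 (n * n)) (cong (2 ^ s *_) (^-distribʳ-* s n n))) ⟩
    L ^ k * (2 ^ s * (L * L))            ≡⟨ swap′ (L ^ k) (2 ^ s) (L * L) ⟩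
    L * L * (2 ^ s * L ^ k)              ∎)
    where
    open ≤-Reasoning
    L = n ^ s
    e = congruentPairs d n
    T = ∑[ x ∈ allFuns k (cube s n) ] 𝟙 (congruent? d (x i) (x j))
    instance
      n≢0 : NonZero n
      n≢0 = >-nonZero (≤-trans (>-nonZero⁻¹ d) d≤n)
      L≢0 : NonZero L
      L≢0 = m^n≢0 n s
    d²≤dˢ : d * d ≤ d ^ s
    d²≤dˢ = subst (_≤ d ^ s) (cong (d *_) (*-identityʳ d)) (^-monoʳ-≤ d 2≤s)
    marginal : L * (L * T) ≡ L ^ k * e ^ s
    marginal = trans (subst (λ z → z * (z * T) ≡ z ^ k * ∑[ x ∈ cube s n ] ∑[ y ∈ cube s n ] 𝟙 (congruent? d x y)) (length-cube s n)
      (∑-marginal₂ k (cube s n) i j i≢j (λ x y → 𝟙 (congruent? d x y)))) (cong (L ^ k *_) (∑-congruent-cube s d n))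
    rearrange : ∀ l a t → l * l * (a * t) ≡ a * (l * (l * t))
    rearrange = solve-∀
    swap : ∀ a b c → a * (b * c) ≡ b * (a * c)
    swap = solve-∀
    swap′ : ∀ a b c → a * (b * c) ≡ c * (b * a)
    swap′ = solve-∀

  -- Telescoping against 1/d² ≤ 1/(d-1) - 1/d, with denominators cleared.
  ∑-inverse-square : ∀ K (T : ℕ → ℕ) m r → (∀ d → m < d → d ≤ m + r → d * d * T d ≤ K) →
                     m * ∑[ d ∈ upTo r ] T (suc (m + d)) ≤ K
  ∑-inverse-square K T m zero    le = ≤-trans (≤-reflexive (*-zeroʳ m)) z≤n
  ∑-inverse-square K T m (suc r) le = *-cancelˡ-≤ (suc m * suc m) (begin
    suc m * suc m * (m * ∑[ d ∈ upTo (suc r) ] T (suc (m + d)))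
      ≡⟨ cong (λ z → suc m * suc m * (m * z)) (trans (∑-upTo-suc r (λ d → T (suc (m + d))))
           (cong₂ _+_ (cong (T ∘ suc) (+-identityʳ m)) (∑-cong (upTo r) (λ d → cong (T ∘ suc) (+-suc m d))))) ⟩
    suc m * suc m * (m * (T (suc m) + S))
      ≡⟨ expand m (T (suc m)) S ⟩
    m * (suc m * suc m * T (suc m)) + m * suc m * (suc m * S)
      ≤⟨ +-mono-≤ (*-monoʳ-≤ m (le (suc m) ≤-refl (≤-trans (s≤s (m≤m+n m r)) (≤-reflexive (sym (+-suc m r))))))
                  (*-monoʳ-≤ (m * suc m) (∑-inverse-square K T (suc m) r
                    (λ d m<d d≤ → le d (<-trans (n<1+n m) m<d) (≤-trans d≤ (≤-reflexive (sym (+-suc m r))))))) ⟩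
    m * K + m * suc m * K
      ≤⟨ m≤m+n _ K ⟩
    m * K + m * suc m * K + K
      ≡⟨ square m K ⟩
    suc m * suc m * K ∎)
    where
    open ≤-Reasoning
    S = ∑[ d ∈ upTo r ] T (suc (suc m + d))
    expand : ∀ m t u → (1 + m) * (1 + m) * (m * (t + u)) ≡ m * ((1 + m) * (1 + m) * t) + m * (1 + m) * ((1 + m) * u)
    expand = solve-∀
    square : ∀ m k → m * k + m * (1 + m) * k + k ≡ (1 + m) * (1 + m) * k
    square = solve-∀

-- Mutual visibility in terms of the gcd of the coordinate differences.

module LatticeVisibility where

  open Summation
  open Congruences
  open import Data.Nat
  open import Data.Nat.Properties
  open import Data.Nat.Divisibility
  open import Data.Nat.GCD using (gcd; gcd[m,n]∣m; gcd[m,n]∣n; gcd-greatest; c*gcd[m,n]≡gcd[cm,cn])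
  open import Data.Nat.Primality using (Prime)
  open import Data.Nat.Primality.Factorisation using (factorise)
  open import Data.Nat.ListAction using (product)
  open import Data.Integer as ℤ using (ℤ; +_; _⊖_; 1ℤ)
  open import Data.Integer.Properties using ([1+m]⊖[1+n]≡m⊖n; m-n≡m⊖n; ⊖-≥; +-injective; abs-*)
  open import Data.Integer.Divisibility.Signed using (∣ᵤ⇒∣; divides)
  open import Data.Integer.Tactic.RingSolver using () renaming (solve-∀ to solveℤ-∀)
  open import Data.Fin using (Fin; zero; suc)
  open import Data.Fin.Properties using (¬∀⟶∃¬)
  open import Data.List using ([]; _∷_)
  open import Data.List.Relation.Unary.All using ([]; _∷_)
  open import Data.Product using (_×_; _,_; proj₁; proj₂; ∃)
  open import Function using (_∘_)
  open import Relation.Nullary using (¬_; contradiction)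
  open import Relation.Binary.PropositionalEquality

  point : ∀ {s} → (Fin s → ℕ) → Point s
  point x c = + suc (x c)

  ∣⊖∣≡∣-∣ : ∀ m n → ℤ.∣ m ⊖ n ∣ ≡ ∣ m - n ∣
  ∣⊖∣≡∣-∣ zero    zero    = refl
  ∣⊖∣≡∣-∣ zero    (suc n) = refl
  ∣⊖∣≡∣-∣ (suc m) zero    = refl
  ∣⊖∣≡∣-∣ (suc m) (suc n) = trans (cong ℤ.∣_∣ ([1+m]⊖[1+n]≡m⊖n m n)) (∣⊖∣≡∣-∣ m n)

  ∣point-point∣ : ∀ {s} (x y : Fin s → ℕ) c → ℤ.∣ point y c ℤ.- point x c ∣ ≡ ∣ x c - y c ∣
  ∣point-point∣ x y c = trans (cong ℤ.∣_∣ (m-n≡m⊖n (suc (y c)) (suc (x c))))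
    (trans (∣⊖∣≡∣-∣ (suc (y c)) (suc (x c))) (∣-∣-comm (y c) (x c)))

  -- The point one `d`-th of the way from the first end to the second has integer coordinates, and
  -- its parameter `1/d` is interior as `d ≥ 2`. Coincident points need no separate case: the
  -- witness is then the point itself, which still solves the segment equation.
  congruent⇒¬◇ : ∀ {s d} (x y : Fin s → ℕ) → 2 ≤ d → Congruent d x y → ¬ (point x ◇ point y)
  congruent⇒¬◇ {s} {suc d} x y 2≤d x~y (_ , no-interior) = no-interior Z 1 (suc d) z<s 2≤d on-segment
    where
    q : ∀ c → ∃ λ q → point y c ℤ.- point x c ≡ q ℤ.* (1ℤ ℤ.+ + d)
    q c with ∣ᵤ⇒∣ {+ suc d} {point y c ℤ.- point x c} (subst (suc d ∣_) (sym (∣point-point∣ x y c)) (x~y c))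
    ... | divides q eq = q , eq
    Z : Point s
    Z c = point x c ℤ.+ proj₁ (q c)
    interpolate : ∀ D X Y q → Y ℤ.- X ≡ q ℤ.* (1ℤ ℤ.+ D) → (1ℤ ℤ.+ D) ℤ.* (X ℤ.+ q) ≡ D ℤ.* X ℤ.+ 1ℤ ℤ.* Y
    interpolate D X Y q eq = trans (lhs D X q) (trans (cong (λ e → (1ℤ ℤ.+ D) ℤ.* X ℤ.+ e) (sym eq)) (rhs D X Y))
      where
      lhs : ∀ D X q → (1ℤ ℤ.+ D) ℤ.* (X ℤ.+ q) ≡ (1ℤ ℤ.+ D) ℤ.* X ℤ.+ q ℤ.* (1ℤ ℤ.+ D)
      lhs = solveℤ-∀
      rhs : ∀ D X Y → (1ℤ ℤ.+ D) ℤ.* X ℤ.+ (Y ℤ.- X) ≡ D ℤ.* X ℤ.+ 1ℤ ℤ.* Y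
      rhs = solveℤ-∀
    on-segment : ∀ c → + suc d ℤ.* Z c ≡ + (suc d ∸ 1) ℤ.* point x c ℤ.+ + 1 ℤ.* point y c
    on-segment c = interpolate (+ d) (point x c) (point y c) (proj₁ (q c)) (proj₂ (q c))

  gcds : ∀ {s} → (Fin s → ℕ) → ℕ
  gcds {zero}  f = 0
  gcds {suc s} f = gcd (f zero) (gcds (f ∘ suc))

  gcds-∣ : ∀ {s} (f : Fin s → ℕ) c → gcds f ∣ f c
  gcds-∣ f zero    = gcd[m,n]∣m (f zero) _
  gcds-∣ f (suc c) = ∣-trans (gcd[m,n]∣n (f zero) _) (gcds-∣ (f ∘ suc) c)

  -- Scaling commutes with gcd. The multiplier `a` gives Euclid's lemma for a whole vector: when the
  -- gcd is 1, a common divisor of all `a * f c` divides `a`.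
  *-gcds-greatest : ∀ {s} a {b} (f : Fin s → ℕ) → (∀ c → b ∣ a * f c) → b ∣ a * gcds f
  *-gcds-greatest {zero}  a {b} f b∣ = subst (b ∣_) (sym (*-zeroʳ a)) (b ∣0)
  *-gcds-greatest {suc s} a {b} f b∣ = subst (b ∣_) (sym (c*gcd[m,n]≡gcd[cm,cn] a (f zero) _))
    (gcd-greatest (b∣ zero) (*-gcds-greatest a (f ∘ suc) (b∣ ∘ suc)))

  -- A lattice point at parameter `a/b` gives `a (Y - X) = b (Z - X)`, so `b` divides `a` times
  -- every difference and hence `a` itself, against `0 < a < b`.
  coprime⇒◇ : ∀ {s} (x y : Fin s → ℕ) → gcds (λ c → ∣ x c - y c ∣) ≡ 1 → point x ◇ point y
  coprime⇒◇ {s} x y gcds≡1 = distinct , no-interior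
    where
    diff : Fin s → ℕ
    diff c = ∣ x c - y c ∣
    ∣a*1 : ∀ {a b} → (∀ c → b ∣ a * diff c) → b ∣ a
    ∣a*1 {a} {b} b∣ = subst (b ∣_) (trans (cong (a *_) gcds≡1) (*-identityʳ a)) (*-gcds-greatest a diff b∣)
    distinct : ¬ (point x ≈ₚ point y)
    -- If the points agreed, every number would divide all the differences; 2 would then divide
    -- their gcd 1.
    distinct x≈y with ∣1⇒≡1 (∣a*1 {1} {2} λ c → subst (2 ∣_) (sym (trans (+-identityʳ (diff c))
                        (m≡n⇒∣m-n∣≡0 (suc-injective (+-injective (x≈y c)))))) (2 ∣0))
    ... | ()
    no-interior : ∀ (Z : Point s) a b → 0 < a → a < b →
                  ¬ (∀ c → + b ℤ.* Z c ≡ + (b ∸ a) ℤ.* point x c ℤ.+ + a ℤ.* point y c)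
    no-interior Z a b 0<a a<b on-segment = <⇒≱ a<b (∣⇒≤ {{>-nonZero 0<a}} (∣a*1 λ c →
      divides-abs c (extract (+ b) (+ a) (Z c) (point x c) (point y c)
        (trans (on-segment c) (cong (λ e → e ℤ.* point x c ℤ.+ + a ℤ.* point y c)
          (sym (trans (m-n≡m⊖n b a) (⊖-≥ (<⇒≤ a<b)))))))))
      where
      extract : ∀ B A Z X Y → B ℤ.* Z ≡ (B ℤ.- A) ℤ.* X ℤ.+ A ℤ.* Y → A ℤ.* (Y ℤ.- X) ≡ (Z ℤ.- X) ℤ.* B
      extract B A Z X Y eq = trans (move A B X Y) (trans (cong (ℤ._- B ℤ.* X) (sym eq)) (factor B X Z))
        where
        move : ∀ A B X Y → A ℤ.* (Y ℤ.- X) ≡ (B ℤ.- A) ℤ.* X ℤ.+ A ℤ.* Y ℤ.- B ℤ.* X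
        move = solveℤ-∀
        factor : ∀ B X Z → B ℤ.* Z ℤ.- B ℤ.* X ≡ (Z ℤ.- X) ℤ.* B
        factor = solveℤ-∀
      divides-abs : ∀ c → + a ℤ.* (point y c ℤ.- point x c) ≡ (Z c ℤ.- point x c) ℤ.* + b → b ∣ a * diff c
      divides-abs c eq = Data.Nat.Divisibility.divides ℤ.∣ Z c ℤ.- point x c ∣ (begin
        a * diff c                                      ≡⟨ cong (a *_) (∣point-point∣ x y c) ⟨
        a * ℤ.∣ point y c ℤ.- point x c ∣               ≡⟨ abs-* (+ a) _ ⟨
        ℤ.∣ + a ℤ.* (point y c ℤ.- point x c) ∣         ≡⟨ cong ℤ.∣_∣ eq ⟩
        ℤ.∣ (Z c ℤ.- point x c) ℤ.* + b ∣               ≡⟨ abs-* (Z c ℤ.- point x c) (+ b) ⟩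
        ℤ.∣ Z c ℤ.- point x c ∣ * b                     ∎)
        where open ≡-Reasoning

  ∃-prime-divisor : ∀ g → 2 ≤ g → ∃ λ p → Prime p × p ∣ g
  ∃-prime-divisor g@(suc _) 2≤g with factorise g
  ... | record { factors = [] ; isFactorisation = g≡1 } = contradiction (subst (2 ≤_) g≡1 2≤g) λ { (s≤s ()) }
  ... | record { factors = p ∷ ps ; isFactorisation = eq ; factorsPrime = p-prime ∷ _ } =
    p , p-prime , subst (p ∣_) (sym eq) (m∣m*n (product ps))

  -- Split on the gcd of the differences: 0 means coincident points, 1 contradicts invisibility, and
  -- otherwise a prime divisor of the gcd exceeds `m`, as the primes up to `m` have been excluded.
  ¬◇⇒∃-large-divisor : ∀ {s m n} (x y : Fin s → ℕ) → m < n → (∀ c → x c < n) → (∀ c → y c < n) →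
    (∀ p → Prime p → p ≤ m → ¬ Congruent p x y) → ¬ (point x ◇ point y) →
    ∃ λ d → m < d × d ≤ n × Congruent d x y
  ¬◇⇒∃-large-divisor {s} {m} {n} x y m<n x<n y<n small ¬x◇y = by-gcds (gcds diff) refl
    where
    diff : Fin s → ℕ
    diff c = ∣ x c - y c ∣
    by-gcds : ∀ g → gcds diff ≡ g → ∃ λ d → m < d × d ≤ n × Congruent d x y
    -- Coincident points are congruent for every modulus; the least admissible one is chosen, and
    -- `m < n` keeps it in range.
    by-gcds 0 eq = suc m , ≤-refl , m<n , λ c →
      subst (suc m ∣_) (sym (0∣⇒≡0 (subst (_∣ diff c) eq (gcds-∣ diff c)))) (suc m ∣0)
    by-gcds 1 eq = contradiction (coprime⇒◇ x y eq) ¬x◇y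
    by-gcds (suc (suc g)) eq = p , ≰⇒> (λ p≤m → small p p-prime p≤m p∣diff) , p≤n , p∣diff
      where
      prime-divisor = ∃-prime-divisor (suc (suc g)) (s≤s (s≤s z≤n))
      p = proj₁ prime-divisor
      p-prime = proj₁ (proj₂ prime-divisor)
      p∣diff : Congruent p x y
      p∣diff c = ∣-trans (subst (p ∣_) (sym eq) (proj₂ (proj₂ prime-divisor))) (gcds-∣ diff c)
      -- If all the differences vanished, 0 would divide their gcd, which is at least 2.
      not-all-zero : ¬ (∀ c → diff c ≡ 0)
      not-all-zero all-zero with 0∣⇒≡0 (subst (0 ∣_) (trans (+-identityʳ _) eq)
        (*-gcds-greatest 1 {0} diff (λ c → subst (0 ∣_) (sym (trans (+-identityʳ (diff c)) (all-zero c))) (0 ∣0))))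
      ... | ()
      -- `p` divides some nonzero difference of two numbers below `n`.
      p≤n : p ≤ n
      p≤n with ¬∀⟶∃¬ s (λ c → diff c ≡ 0) (λ c → diff c ≟ 0) not-all-zero
      ... | c , diff≢0 = ≤-trans (∣⇒≤ {{≢-nonZero diff≢0}} (p∣diff c))
                           (≤-trans (∣m-n∣≤m⊔n (x c) (y c)) (<⇒≤ (⊔-lub (x<n c) (y<n c))))

  ◇-resp : ∀ {s} {X X′ Y Y′ : Point s} → X ≈ₚ X′ → Y ≈ₚ Y′ → X ◇ Y → X′ ◇ Y′
  ◇-resp X≈X′ Y≈Y′ (distinct , no-interior) =
    (λ X′≈Y′ → distinct (λ i → trans (X≈X′ i) (trans (X′≈Y′ i) (sym (Y≈Y′ i))))) ,
    λ Z a b 0<a a<b on-segment → no-interior Z a b 0<a a<b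
      (λ i → trans (on-segment i) (cong₂ (λ u v → + (b ∸ a) ℤ.* u ℤ.+ + a ℤ.* v) (sym (X≈X′ i)) (sym (Y≈Y′ i))))

-- The sieve by finitely many primes and its comparison with visibility.

module Sieving where

  open Summation
  open Congruences
  open LatticeVisibility
  open import Data.Bool using (true)
  open import Data.Bool.Properties using () renaming (_≟_ to _≟ᵇ_)
  open import Data.Nat
  open import Data.Nat.Properties
  open import Data.Nat.DivMod
  open import Data.Nat.Divisibility
  open import Data.Nat.Primality using (Prime; prime⇒nonZero; productOfPrimes≢0; prime⇒nonTrivial)
  open import Data.Nat.Primality.Factorisation using (factorisationHasAllPrimeFactors)
  open import Data.Nat.ListAction using (product)
  open import Data.Nat.ListAction.Properties using (∈⇒∣product)
  open import Data.Nat.Tactic.RingSolver using (solve-∀)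
  open import Data.Integer as ℤ using (ℤ)
  open import Data.Fin using (Fin; zero; suc; combine; funToFin; finToFun)
  open import Data.Fin.Properties as Finₚ using (all?; ¬∀⟶∃¬; finToFun-funToFin)
  open import Data.List using (List; []; _∷_; map; length; allFin; upTo)
  open import Data.List.Properties using (length-tabulate)
  open import Data.List.Membership.Propositional using (_∈_)
  open import Data.List.Membership.Propositional.Properties using (∈-allFin; ∈-upTo⁺)
  open import Data.List.Relation.Unary.Any using (here; there)
  open import Data.List.Relation.Unary.All as All using (All; []; _∷_)
  open import Data.List.Relation.Unary.All.Properties using (concat⁺; map⁺; all-upTo; All¬⇒¬Any)
  open import Data.List.Relation.Unary.AllPairs using ([]; _∷_)
  open import Data.List.Relation.Unary.Unique.Propositional using (Unique)
  open import Data.Product using (_×_; _,_; proj₂; ∃₂)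
  open import Function using (_∘_; id)
  open import Relation.Nullary using (Dec; yes; no; ¬_; ¬?; contradiction)
  open import Relation.Nullary.Decidable using (_→-dec_; _×-dec_)
  open import Relation.Binary.PropositionalEquality

  private variable
    A : Set

  All-allFuns : ∀ {P : A → Set} {xs} → All P xs → ∀ m → All (λ f → ∀ i → P (f i)) (allFuns m xs)
  All-allFuns all-xs zero    = (λ ()) ∷ []
  All-allFuns all-xs (suc m) = concat⁺ (map⁺ (All.map (λ Pa → map⁺ (All.map (λ Pf → λ { zero → Pa ; (suc i) → Pf i })
    (All-allFuns all-xs m))) all-xs))

  ∑-mono-All : ∀ {P : A → Set} {xs : List A} {f g : A → ℕ} → All P xs → (∀ x → P x → f x ≤ g x) → ∑ xs f ≤ ∑ xs g
  ∑-mono-All []         le = z≤n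
  ∑-mono-All (Px ∷ Pxs) le = +-mono-≤ (le _ Px) (∑-mono-All Pxs le)

  ∈⇒≤∑ : ∀ {x : A} {xs} → x ∈ xs → ∀ f → f x ≤ ∑ xs f
  ∈⇒≤∑ (here refl)  f = m≤m+n _ _
  ∈⇒≤∑ (there x∈xs) f = ≤-trans (∈⇒≤∑ x∈xs f) (m≤n+m _ _)

  funToFin-cong : ∀ {s p} {f g : Fin s → Fin p} → (∀ c → f c ≡ g c) → funToFin f ≡ funToFin g
  funToFin-cong {zero}  eq = refl
  funToFin-cong {suc s} eq = cong₂ combine (eq zero) (funToFin-cong (eq ∘ suc))

  funToFin-injective : ∀ {s p} {f g : Fin s → Fin p} → funToFin f ≡ funToFin g → ∀ c → f c ≡ g c
  funToFin-injective {f = f} {g} eq c = trans (sym (finToFun-funToFin f c)) (trans (cong (λ e → finToFun e c) eq) (finToFun-funToFin g c))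

  -- `funToFin` reads a residue vector as the base-`p` digits of a colour, a bijection by induction
  -- on the digits. This is how `p ^ s` colours enter.
  Covers-funToFin : ∀ s p → Covers₁ _≡_ (allFuns s (allFin p)) funToFin 1 (allFin (p ^ s))
  Covers-funToFin zero    p h _ = sym (+-identityʳ _)
  Covers-funToFin (suc s) p h _ = begin
    ∑[ f ∈ allFuns (suc s) (allFin p) ] h (funToFin f)
      ≡⟨ ∑-allFuns s (allFin p) _ (λ eq → cong h (funToFin-cong eq)) ⟩
    ∑[ a ∈ allFin p ] ∑[ f ∈ allFuns s (allFin p) ] h (combine a (funToFin f))
      ≡⟨ ∑-cong (allFin p) (λ a → trans (Covers-funToFin s p (h ∘ combine a) (cong (h ∘ combine a))) (*-identityˡ _)) ⟩
    ∑[ a ∈ allFin p ] ∑[ b ∈ allFin (p ^ s) ] h (combine a b)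
      ≡⟨ ∑-allFin-* p (p ^ s) h ⟨
    ∑ (allFin (p ^ suc s)) h
      ≡⟨ *-identityˡ _ ⟨
    1 * ∑ (allFin (p ^ suc s)) h ∎
    where open ≡-Reasoning

  𝟙-complement : {P : Set} (P? : Dec P) → 𝟙 P? + 𝟙 (¬? P?) ≡ 1
  𝟙-complement (yes _) = refl
  𝟙-complement (no  _) = refl

  ^-trivial : ∀ s k → (1 ^ s) ^ k ≡ 1
  ^-trivial s k = trans (cong (_^ k) (^-zeroˡ s)) (^-zeroˡ k)

  module Sieve {k : ℕ} (H : Graph k) (s : ℕ) where

    Tuple : Set
    Tuple = Fin k → Fin s → ℕ

    tuples : ℕ → List Tuple
    tuples n = allFuns k (cube s n)

    length-tuples : ∀ n → length (tuples n) ≡ (n ^ s) ^ k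
    length-tuples n = trans (length-allFuns k (cube s n)) (cong (_^ k) (length-cube s n))

    ∑-tuples-1 : ∀ n → ∑[ X ∈ tuples n ] 1 ≡ (n ^ s) ^ k
    ∑-tuples-1 n = trans (sym (length≡∑1 (tuples n))) (length-tuples n)

    Avoids : ℕ → Tuple → Set
    Avoids p X = ∀ i j → adj H i j ≡ true → ¬ Congruent p (X i) (X j)

    avoids? : ∀ p X → Dec (Avoids p X)
    avoids? p X = all? (λ i → all? (λ j → (adj H i j ≟ᵇ true) →-dec ¬? (congruent? p (X i) (X j))))

    AvoidsAll : List ℕ → Tuple → Set
    AvoidsAll ps X = All (λ p → Avoids p X) ps

    avoidsAll? : ∀ ps X → Dec (AvoidsAll ps X)
    avoidsAll? ps X = All.all? (λ p → avoids? p X) ps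

    _≋_ : Tuple → Tuple → Set
    _≋_ = Pointwise (Pointwise _≡_)

    ≋-sym : ∀ {X Y} → X ≋ Y → Y ≋ X
    ≋-sym X≋Y i c = sym (X≋Y i c)

    AvoidsAll-resp : ∀ {ps X Y} → X ≋ Y → AvoidsAll ps X → AvoidsAll ps Y
    AvoidsAll-resp X≋Y = All.map λ avoids i j ij Yi~Yj →
      avoids i j ij (Congruent-resp (λ c → sym (X≋Y i c)) (λ c → sym (X≋Y j c)) Yi~Yj)

    𝟙-avoidsAll-resp : ∀ ps → Respects _≋_ (λ X → 𝟙 (avoidsAll? ps X))
    𝟙-avoidsAll-resp ps {X} {Y} X≋Y = 𝟙-cong (avoidsAll? ps X) (avoidsAll? ps Y) (AvoidsAll-resp X≋Y) (AvoidsAll-resp (≋-sym X≋Y))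

    𝟙-avoidsAll-∷ : ∀ p ps X → 𝟙 (avoidsAll? (p ∷ ps) X) ≡ 𝟙 (avoids? p X) * 𝟙 (avoidsAll? ps X)
    𝟙-avoidsAll-∷ p ps X = trans (𝟙-cong (avoidsAll? (p ∷ ps) X) (avoids? p X ×-dec avoidsAll? ps X)
      (λ { (a ∷ as) → a , as }) (λ { (a , as) → a ∷ as })) (𝟙-× (avoids? p X) (avoidsAll? ps X))

    sieve : List ℕ → ℕ → ℕ
    sieve ps n = ∑[ X ∈ tuples n ] 𝟙 (avoidsAll? ps X)

    chromatics : List ℕ → ℕ
    chromatics ps = product (map (λ p → chromatic H (p ^ s)) ps)

    proper? : ∀ {x} (c : Fin k → Fin x) → Dec (Proper H c)
    proper? c = all? (λ i → all? (λ j → (adj H i j ≟ᵇ true) →-dec ¬? (c i Finₚ.≟ c j)))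

    Proper-resp : ∀ {x} {c c′ : Fin k → Fin x} → (∀ i → c i ≡ c′ i) → Proper H c → Proper H c′
    Proper-resp eq proper i j ij c′i≡c′j = proper i j ij (trans (eq i) (trans c′i≡c′j (sym (eq j))))

    𝟙-proper-resp : ∀ {x} → Respects (Pointwise _≡_) (λ (c : Fin k → Fin x) → 𝟙 (proper? c))
    𝟙-proper-resp {x} {c} {c′} eq = 𝟙-cong (proper? c) (proper? c′) (Proper-resp eq) (Proper-resp (sym ∘ eq))

    ∑-proper-residues : ∀ p → ∑[ Y ∈ allFuns k (allFuns s (allFin p)) ] 𝟙 (proper? (funToFin ∘ Y)) ≡ chromatic H (p ^ s)
    ∑-proper-residues p = begin
      ∑[ Y ∈ allFuns k (allFuns s (allFin p)) ] 𝟙 (proper? (funToFin ∘ Y))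
        ≡⟨ Covers₁-allFuns refl {xs = allFuns s (allFin p)} (Covers-funToFin s p) k (λ c → 𝟙 (proper? c)) 𝟙-proper-resp ⟩
      1 ^ k * ∑[ c ∈ allFuns k (allFin (p ^ s)) ] 𝟙 (proper? c)
        ≡⟨ trans (cong₂ _*_ (^-zeroˡ k) refl) (*-identityˡ _) ⟩
      ∑[ c ∈ allFuns k (allFin (p ^ s)) ] 𝟙 (proper? c)
        ≡⟨ length-filter-𝟙 proper? (allFuns k (allFin (p ^ s))) ⟨
      chromatic H (p ^ s) ∎
      where open ≡-Reasoning

    𝟙-avoids-residue : ∀ p .{{_ : NonZero p}} X → 𝟙 (avoids? p X) ≡ 𝟙 (proper? (λ i → funToFin (residue p ∘ X i)))
    𝟙-avoids-residue p X = 𝟙-cong (avoids? p X) (proper? _)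
      (λ avoids i j ij eq → avoids i j ij (λ c → residue≡⇒∣-∣ p _ _ (funToFin-injective eq c)))
      (λ proper i j ij Xi~Xj → proper i j ij (funToFin-cong (λ c → ∣-∣⇒residue≡ p _ _ (Xi~Xj c))))

    AvoidsAll-% : ∀ {ps} → All Prime ps → ∀ Q .{{_ : NonZero Q}} → (∀ {p} → p ∈ ps → p ∣ Q) → ∀ X →
                  𝟙 (avoidsAll? ps X) ≡ 𝟙 (avoidsAll? ps (λ i c → X i c % Q))
    AvoidsAll-% {ps} primes Q ∣Q X = 𝟙-cong (avoidsAll? ps X) (avoidsAll? ps (λ i c → X i c % Q))
      (λ as → All.tabulate λ {p} p∈ps i j ij Xi~Xj → All.lookup as p∈ps i j ij
        (λ c → ∣-∣-%⁻ Q {{prime⇒nonZero (All.lookup primes p∈ps)}} (∣Q p∈ps) (X i c) (X j c) (Xi~Xj c)))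
      (λ as → All.tabulate λ {p} p∈ps i j ij Xi~Xj → All.lookup as p∈ps i j ij
        (λ c → ∣-∣-%⁺ Q {{prime⇒nonZero (All.lookup primes p∈ps)}} (∣Q p∈ps) (X i c) (X j c) (Xi~Xj c)))

    -- One prime is split off at a time. The condition at `p` depends only on the residues modulo
    -- `p`, the others only on those modulo `Q`, so by the Chinese remainder theorem the count
    -- factors.
    sieve-product : ∀ {ps} → All Prime ps → Unique ps → sieve ps (product ps) ≡ chromatics ps
    -- The empty product is side 1, with exactly one tuple and no condition on it.
    sieve-product []                 []               = trans (∑-tuples-1 1) (^-trivial s k)
    sieve-product {p ∷ ps} (p-prime ∷ primes) (p≢ps ∷ unique) = begin
      ∑[ X ∈ tuples (p * Q) ] 𝟙 (avoidsAll? (p ∷ ps) X)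
        ≡⟨ ∑-cong (tuples (p * Q)) (λ X → trans (𝟙-avoidsAll-∷ p ps X)
             (cong₂ _*_ (𝟙-avoids-residue p X) (AvoidsAll-% primes Q ∈⇒∣product X))) ⟩
      ∑[ X ∈ tuples (p * Q) ] (colour (λ i → residue p ∘ X i) * rest (λ i c → X i c % Q))
        -- The inner lift passes from one coordinate to `s`, the outer one from one point to `k`.
        ≡⟨ Covers-allFuns {R = Pointwise _≡_} {S = Pointwise _≡_} (λ _ → refl) (λ _ → refl) {xs = cube s (p * Q)}
             (Covers-allFuns {R = _≡_} {S = _≡_} refl refl {xs = upTo (p * Q)} (Covers-CRT Q p-prime p∤Q) s) k
             (λ Y Z → colour Y * rest Z)
             (λ Y≋Y′ Z≋Z′ → cong₂ _*_ (𝟙-proper-resp (λ i → funToFin-cong (Y≋Y′ i))) (𝟙-avoidsAll-resp ps Z≋Z′)) ⟩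
      (1 ^ s) ^ k * ∑[ Y ∈ residues ] ∑[ Z ∈ tuples Q ] (colour Y * rest Z)
        ≡⟨ trans (cong₂ _*_ (^-trivial s k) refl) (*-identityˡ _) ⟩
      ∑[ Y ∈ residues ] ∑[ Z ∈ tuples Q ] (colour Y * rest Z)
        ≡⟨ ∑-cong residues (λ Y → ∑-*ˡ (tuples Q) (colour Y) rest) ⟩
      ∑[ Y ∈ residues ] (colour Y * sieve ps Q)
        ≡⟨ ∑-*ʳ residues (sieve ps Q) colour ⟩
      ∑ residues colour * sieve ps Q
        ≡⟨ cong₂ _*_ (∑-proper-residues p) (sieve-product primes unique) ⟩
      chromatics (p ∷ ps) ∎
      where
      open ≡-Reasoning
      Q = product ps
      instance
        p≢0 : NonZero p
        p≢0 = prime⇒nonZero p-prime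
        Q≢0 : NonZero Q
        Q≢0 = productOfPrimes≢0 primes
      -- A prime dividing a product of primes is one of them, which `Unique` rules out for `p`.
      p∤Q : ¬ p ∣ Q
      p∤Q p∣Q = All¬⇒¬Any p≢ps (factorisationHasAllPrimeFactors p-prime p∣Q primes)
      residues : List (Fin k → Fin s → Fin p)
      residues = allFuns k (allFuns s (allFin p))
      colour : (Fin k → Fin s → Fin p) → ℕ
      colour Y = 𝟙 (proper? (funToFin ∘ Y))
      rest : Tuple → ℕ
      rest Z = 𝟙 (avoidsAll? ps Z)

    -- Each residue modulo the product has `t` lifts per coordinate, and there are `s` coordinates
    -- in each of `k` points.
    sieve-multiple : ∀ {ps} → All Prime ps → Unique ps → ∀ t → sieve ps (t * product ps) ≡ (t ^ s) ^ k * chromatics ps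
    sieve-multiple {ps} primes unique t = begin
      ∑[ X ∈ tuples (t * Q) ] 𝟙 (avoidsAll? ps X)
        ≡⟨ ∑-cong (tuples (t * Q)) (AvoidsAll-% primes Q ∈⇒∣product) ⟩
      ∑[ X ∈ tuples (t * Q) ] 𝟙 (avoidsAll? ps (λ i c → X i c % Q))
        ≡⟨ Covers₁-allFuns {R = Pointwise _≡_} (λ _ → refl) {xs = cube s (t * Q)}
             (Covers₁-allFuns {R = _≡_} refl {xs = upTo (t * Q)} (Covers-% t Q) s) k
             (λ X → 𝟙 (avoidsAll? ps X)) (𝟙-avoidsAll-resp ps) ⟩
      (t ^ s) ^ k * sieve ps Q
        ≡⟨ cong ((t ^ s) ^ k *_) (sieve-product primes unique) ⟩
      (t ^ s) ^ k * chromatics ps ∎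
      where
      open ≡-Reasoning
      Q = product ps
      instance
        Q≢0 : NonZero Q
        Q≢0 = productOfPrimes≢0 primes

    sieve-antimono : ∀ {ps qs} → (∀ {p} → p ∈ ps → p ∈ qs) → ∀ n → sieve qs n ≤ sieve ps n
    sieve-antimono {ps} {qs} ps⊆qs n = ∑-mono (tuples n) λ X → 𝟙-mono (avoidsAll? qs X) (avoidsAll? ps X)
      (λ as → All.tabulate (All.lookup as ∘ ps⊆qs))

    ∑-tuples-mono : ∀ {m n} → m ≤ n → ∀ h → Respects _≋_ h → ∑ (tuples m) h ≤ ∑ (tuples n) h
    ∑-tuples-mono {m} {n} m≤n = ∑-allFuns-mono {R = Pointwise _≡_} (λ _ → refl) (cube s m) (cube s n)
      (∑-allFuns-mono {R = _≡_} refl (upTo m) (upTo n) (λ h _ → ∑-upTo-mono m≤n h) s) k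

    -- Obtained by counting the complement, which is also monotone in n.
    sieve-growth : ∀ ps {m n} → m ≤ n → sieve ps n + (m ^ s) ^ k ≤ sieve ps m + (n ^ s) ^ k
    sieve-growth ps {m} {n} m≤n = begin
      sieve ps n + (m ^ s) ^ k                    ≡⟨ cong (sieve ps n +_) (complement m) ⟨
      sieve ps n + (sieve ps m + sieveᶜ m)        ≤⟨ +-monoʳ-≤ (sieve ps n) (+-monoʳ-≤ (sieve ps m) sieveᶜ-mono) ⟩
      sieve ps n + (sieve ps m + sieveᶜ n)        ≡⟨ exchange (sieve ps n) (sieve ps m) (sieveᶜ n) ⟩
      sieve ps m + (sieve ps n + sieveᶜ n)        ≡⟨ cong (sieve ps m +_) (complement n) ⟩
      sieve ps m + (n ^ s) ^ k                    ∎
      where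
      open ≤-Reasoning
      sieveᶜ : ℕ → ℕ
      sieveᶜ n = ∑[ X ∈ tuples n ] 𝟙 (¬? (avoidsAll? ps X))
      complement : ∀ n → sieve ps n + sieveᶜ n ≡ (n ^ s) ^ k
      complement n = trans (sym (∑-+ (tuples n) _ _))
        (trans (∑-cong (tuples n) (λ X → 𝟙-complement (avoidsAll? ps X))) (∑-tuples-1 n))
      sieveᶜ-mono : sieveᶜ m ≤ sieveᶜ n
      sieveᶜ-mono = ∑-tuples-mono m≤n _ λ {X} {Y} X≋Y → 𝟙-cong (¬? (avoidsAll? ps X)) (¬? (avoidsAll? ps Y))
        (_∘ AvoidsAll-resp (≋-sym X≋Y)) (_∘ AvoidsAll-resp X≋Y)
      exchange : ∀ a b c → a + (b + c) ≡ b + (a + c)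
      exchange = solve-∀

    sieve-mono : ∀ ps {m n} → m ≤ n → sieve ps m ≤ sieve ps n
    sieve-mono ps m≤n = ∑-tuples-mono m≤n _ (𝟙-avoidsAll-resp ps)

    sieve≤ : ∀ ps n → sieve ps n ≤ (n ^ s) ^ k
    sieve≤ ps n = ≤-trans (∑-mono (tuples n) (λ X → 𝟙≤1 (avoidsAll? ps X))) (≤-reflexive (∑-tuples-1 n))

    module Visibility (dec : (X Y : Point s) → Dec (X ◇ Y)) where

      visible? : ∀ (X : Fin k → Point s) → Dec (Visible H X)
      visible? X = all? (λ i → all? (λ j → (adj H i j ≟ᵇ true) →-dec dec (X i) (X j)))

      Visible-resp : ∀ {X Y : Fin k → Point s} → (∀ i → X i ≈ₚ Y i) → Visible H X → Visible H Y
      Visible-resp X≈Y visible i j ij = ◇-resp (X≈Y i) (X≈Y j) (visible i j ij)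

      -- Coordinates run from 0 here and are shifted by one in `point`; differences, and with them
      -- all congruences, are unaffected.
      visibles : ℕ → ℕ
      visibles n = ∑[ X ∈ tuples n ] 𝟙 (visible? (point ∘ X))

      visibleCount≡visibles : ∀ n → visibleCount dec H n ≡ visibles n
      visibleCount≡visibles n = begin
        visibleCount dec H n
          ≡⟨ length-filter-𝟙 visible? (allFuns k (box s n)) ⟩
        ∑[ X ∈ allFuns k (box s n) ] 𝟙 (visible? X)
          ≡⟨ trans (cong₂ _*_ (^-trivial s k) refl) (*-identityˡ _) ⟨
        (1 ^ s) ^ k * ∑[ X ∈ allFuns k (box s n) ] 𝟙 (visible? X)
          ≡⟨ Covers₁-allFuns {R = Pointwise _≡_} (λ _ → refl) {xs = cube s n}
               (Covers₁-allFuns {R = _≡_} refl {xs = upTo n} {φ = λ m → ℤ.+ suc m}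
                 (λ h _ → sym (trans (*-identityˡ _) (∑-map _ (upTo n) h))) s) k
               (λ X → 𝟙 (visible? X))
               (λ {X} {Y} X≈Y → 𝟙-cong (visible? X) (visible? Y) (Visible-resp X≈Y) (Visible-resp (λ i c → sym (X≈Y i c)))) ⟨
        visibles n ∎
        where open ≡-Reasoning

      visibles≤sieve : ∀ {ps} → All Prime ps → ∀ n → visibles n ≤ sieve ps n
      visibles≤sieve {ps} primes n = ∑-mono (tuples n) λ X → 𝟙-mono (visible? (point ∘ X)) (avoidsAll? ps X) λ visible →
        All.map (λ p-prime i j ij Xi~Xj → congruent⇒¬◇ (X i) (X j)
          (nonTrivial⇒n>1 _ {{prime⇒nonTrivial p-prime}}) Xi~Xj (visible i j ij)) primes

      edgeCongruent? : ∀ d i j (X : Tuple) → Dec (adj H i j ≡ true × Congruent d (X i) (X j))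
      edgeCongruent? d i j X = (adj H i j ≟ᵇ true) ×-dec congruent? d (X i) (X j)

      ¬Visible⇒∃-edge : ∀ X → ¬ Visible H X → ∃₂ λ i j → adj H i j ≡ true × ¬ (X i ◇ X j)
      ¬Visible⇒∃-edge X ¬visible with ¬∀⟶∃¬ k _ (λ i → all? (λ j → (adj H i j ≟ᵇ true) →-dec dec (X i) (X j))) ¬visible
      ... | i , ¬∀j with ¬∀⟶∃¬ k _ (λ j → (adj H i j ≟ᵇ true) →-dec dec (X i) (X j)) ¬∀j
      ... | j , ¬ij with adj H i j ≟ᵇ true
      ... | yes ij  = i , j , ij , λ Xi◇Xj → ¬ij (λ _ → Xi◇Xj)
      ... | no  ¬adj = contradiction (λ adj → contradiction adj ¬adj) ¬ij

      -- A union bound: a tuple that passes the sieve without being visible has an invisible edge,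
      -- and a large common divisor of its differences contributes at least 1 to the triple sum.
      avoidsAll≤visible+congruent : ∀ {ps m n} → m < n → (∀ p → Prime p → p ≤ m → p ∈ ps) →
        ∀ X → (∀ i c → X i c < n) →
        𝟙 (avoidsAll? ps X) ≤ 𝟙 (visible? (point ∘ X))
          + ∑[ i ∈ allFin k ] ∑[ j ∈ allFin k ] ∑[ d ∈ upTo (n ∸ m) ] 𝟙 (edgeCongruent? (suc (m + d)) i j X)
      avoidsAll≤visible+congruent {ps} {m} {n} m<n complete X X<n = go (avoidsAll? ps X) (visible? (point ∘ X))
        where
        open ≤-Reasoning
        edge : Fin k → Fin k → ℕ → ℕ
        edge i j d = 𝟙 (edgeCongruent? (suc (m + d)) i j X)
        1≤∑ : ∀ i j → adj H i j ≡ true → ∀ d → m < d → d ≤ n → Congruent d (X i) (X j) →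
              1 ≤ ∑[ i ∈ allFin k ] ∑[ j ∈ allFin k ] ∑[ d ∈ upTo (n ∸ m) ] edge i j d
        1≤∑ i j ij d m<d d≤n Xi~Xj = begin
          1
            ≡⟨ 𝟙-true (edgeCongruent? (suc (m + e)) i j X) (ij , subst (λ d → Congruent d (X i) (X j)) (sym (m+[n∸m]≡n m<d)) Xi~Xj) ⟨
          edge i j e
            ≤⟨ ∈⇒≤∑ (∈-upTo⁺ e<) (edge i j) ⟩
          ∑ (upTo (n ∸ m)) (edge i j)
            ≤⟨ ∈⇒≤∑ (∈-allFin j) (λ j → ∑ (upTo (n ∸ m)) (edge i j)) ⟩
          ∑[ j ∈ allFin k ] ∑ (upTo (n ∸ m)) (edge i j)
            ≤⟨ ∈⇒≤∑ (∈-allFin i) (λ i → ∑[ j ∈ allFin k ] ∑ (upTo (n ∸ m)) (edge i j)) ⟩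
          ∑[ i ∈ allFin k ] ∑[ j ∈ allFin k ] ∑ (upTo (n ∸ m)) (edge i j) ∎
          where
          -- The moduli with `m < d ≤ n` are listed as `suc (m + e)` with `e < n ∸ m`.
          e = d ∸ suc m
          e< : e < n ∸ m
          e< = subst (_≤ n ∸ m) (+-∸-assoc 1 m<d) (∸-monoˡ-≤ m d≤n)
        bad : AvoidsAll ps X → (∃₂ λ i j → adj H i j ≡ true × ¬ (point (X i) ◇ point (X j))) →
              1 ≤ ∑[ i ∈ allFin k ] ∑[ j ∈ allFin k ] ∑[ d ∈ upTo (n ∸ m) ] edge i j d
        bad as (i , j , ij , ¬Xi◇Xj) =
          let d , m<d , d≤n , Xi~Xj = ¬◇⇒∃-large-divisor (X i) (X j) m<n (X<n i) (X<n j)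
                (λ p p-prime p≤m → All.lookup as (complete p p-prime p≤m) i j ij) ¬Xi◇Xj
          in 1≤∑ i j ij d m<d d≤n Xi~Xj
        go : (a? : Dec (AvoidsAll ps X)) (v? : Dec (Visible H (point ∘ X))) →
             𝟙 a? ≤ 𝟙 v? + ∑[ i ∈ allFin k ] ∑[ j ∈ allFin k ] ∑[ d ∈ upTo (n ∸ m) ] edge i j d
        go (no _)   v?            = z≤n
        go (yes as) (yes _)       = s≤s z≤n
        go (yes as) (no ¬visible) = bad as (¬Visible⇒∃-edge (point ∘ X) ¬visible)

      -- A point is congruent to itself for every modulus, so the diagonal is harmless only because
      -- adjacency is part of the event and `H` has no loops. Off the diagonal adjacency may be
      -- forgotten.
      ∑-edgeCongruent : 2 ≤ s → ∀ {d n} .{{_ : NonZero d}} → d ≤ n → ∀ i j →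
        d * d * ∑[ X ∈ tuples n ] 𝟙 (edgeCongruent? d i j X) ≤ 2 ^ s * (n ^ s) ^ k
      ∑-edgeCongruent 2≤s {d} {n} d≤n i j = go (i Finₚ.≟ j)
        where
        go : Dec (i ≡ j) → d * d * ∑[ X ∈ tuples n ] 𝟙 (edgeCongruent? d i j X) ≤ 2 ^ s * (n ^ s) ^ k
        go (yes i≡j) = ≤-trans (≤-reflexive (trans (cong (d * d *_) (trans
          (∑-cong (tuples n) (λ X → 𝟙-false (edgeCongruent? d i j X)
            (λ (ij , _) → loopless H i (subst (λ j → adj H i j ≡ true) (sym i≡j) ij))))
          (trans (∑-const (tuples n) 0) (*-zeroʳ (length (tuples n)))))) (*-zeroʳ (d * d)))) z≤n
        go (no i≢j) = ≤-trans (*-monoʳ-≤ (d * d) (∑-mono (tuples n) (λ X →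
          𝟙-mono (edgeCongruent? d i j X) (congruent? d (X i) (X j)) proj₂))) (∑-congruent-bound 2≤s d≤n i≢j)

      -- After the union bound each of the `k²` ordered pairs, adjacent or not, is charged the full
      -- tail of the inverse squares beyond `m`.
      sieve-tail : 2 ≤ s → ∀ {ps m n} → m < n → (∀ p → Prime p → p ≤ m → p ∈ ps) →
        m * sieve ps n ≤ m * visibles n + k * (k * (2 ^ s * (n ^ s) ^ k))
      sieve-tail 2≤s {ps} {m} {n} m<n complete = begin
        m * sieve ps n
          ≤⟨ *-monoʳ-≤ m (∑-mono-All (All-allFuns (All-allFuns (all-upTo n) s) k) (avoidsAll≤visible+congruent m<n complete)) ⟩
        m * ∑[ X ∈ tuples n ] (𝟙 (visible? (point ∘ X)) + ∑[ i ∈ allFin k ] ∑[ j ∈ allFin k ] ∑[ d ∈ ds ] edge X i j d)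
          ≡⟨ cong (m *_) (∑-+ (tuples n) _ _) ⟩
        m * (visibles n + ∑[ X ∈ tuples n ] ∑[ i ∈ allFin k ] ∑[ j ∈ allFin k ] ∑[ d ∈ ds ] edge X i j d)
          ≡⟨ *-distribˡ-+ m (visibles n) _ ⟩
        m * visibles n + m * ∑[ X ∈ tuples n ] ∑[ i ∈ allFin k ] ∑[ j ∈ allFin k ] ∑[ d ∈ ds ] edge X i j d
          -- The sum over tuples goes innermost, so that each pair and modulus can be bounded
          -- separately.
          ≡⟨ cong (λ e → m * visibles n + m * e) (trans (∑-swap (tuples n) (allFin k) _) (∑-cong (allFin k) λ i →
               trans (∑-swap (tuples n) (allFin k) _) (∑-cong (allFin k) λ j → ∑-swap (tuples n) ds _))) ⟩
        m * visibles n + m * ∑[ i ∈ allFin k ] ∑[ j ∈ allFin k ] ∑[ d ∈ ds ] ∑[ X ∈ tuples n ] edge X i j d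
          ≡⟨ cong (m * visibles n +_) (trans (sym (∑-*ˡ (allFin k) m _)) (∑-cong (allFin k) (λ i → sym (∑-*ˡ (allFin k) m _)))) ⟩
        m * visibles n + ∑[ i ∈ allFin k ] ∑[ j ∈ allFin k ] (m * ∑[ d ∈ ds ] ∑[ X ∈ tuples n ] edge X i j d)
          ≤⟨ +-monoʳ-≤ (m * visibles n) (∑-mono (allFin k) (λ i → ∑-mono (allFin k) (λ j →
               ∑-inverse-square K (λ d → ∑[ X ∈ tuples n ] 𝟙 (edgeCongruent? d i j X)) m (n ∸ m)
                 (λ d m<d d≤ → ∑-edgeCongruent 2≤s {{>-nonZero (≤-<-trans z≤n m<d)}} (≤-trans d≤ (≤-reflexive (m+[n∸m]≡n (<⇒≤ m<n)))) i j)))) ⟩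
        m * visibles n + ∑[ i ∈ allFin k ] ∑[ j ∈ allFin k ] K
          ≡⟨ cong (m * visibles n +_) (trans (∑-cong (allFin k) (λ i → const)) const) ⟩
        m * visibles n + k * (k * K) ∎
        where
        open ≤-Reasoning
        K = 2 ^ s * (n ^ s) ^ k
        ds = upTo (n ∸ m)
        edge : Tuple → Fin k → Fin k → ℕ → ℕ
        edge X i j d = 𝟙 (edgeCongruent? (suc (m + d)) i j X)
        const : ∀ {c} → ∑[ i ∈ allFin k ] c ≡ k * c
        const {c} = trans (∑-const (allFin k) c) (cong (_* c) (length-tabulate (id {A = Fin k})))

-- Rational inequalities reduced to inequalities of natural numbers.

module Fractions where

  open import Data.Nat as ℕ using (ℕ; zero; suc; z≤n; s≤s; NonZero)
  import Data.Nat.Properties as ℕₚ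
  open import Data.Nat.Tactic.RingSolver using (solve-∀)
  open import Data.Integer as ℤ using (+≤+; +<+)
  import Data.Integer.Properties as ℤₚ
  open import Data.Rational hiding (NonZero)
  open import Data.Rational.Properties
  open import Data.Rational.Unnormalised as ℚᵘ using (mkℚᵘ; *≡*)
  import Data.Rational.Unnormalised.Properties as ℚᵘₚ
  open import Algebra.Properties.Group +-0-group using (⁻¹-involutive)
  open import Data.Product using (_,_; ∃; Σ)
  open import Function using (it)
  open import Data.Sum using (inj₁; inj₂)
  open import Relation.Binary.PropositionalEquality

  infix 8 _//_

  _//_ : ℕ → (d : ℕ) → .{{NonZero d}} → ℚ
  a // d = ℤ.+ a / d

  -- Division in `ℚ` cancels common factors and hides numerator and denominator; passing to
  -- unnormalised rationals makes cross-multiplication available.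
  toℚᵘ-// : ∀ a d → toℚᵘ (a // suc d) ℚᵘ.≃ mkℚᵘ (ℤ.+ a) d
  toℚᵘ-// a d = toℚᵘ-fromℚᵘ (mkℚᵘ (ℤ.+ a) d)

  //-mono-≤ : ∀ a b c d .{{_ : NonZero b}} .{{_ : NonZero d}} → a ℕ.* d ℕ.≤ c ℕ.* b → a // b ≤ c // d
  //-mono-≤ a (suc b) c (suc d) ad≤cb = toℚᵘ-cancel-≤ (begin
    toℚᵘ (a // suc b) ≃⟨ toℚᵘ-// a b ⟩
    mkℚᵘ (ℤ.+ a) b      ≤⟨ ℚᵘ.*≤* (subst₂ ℤ._≤_ (ℤₚ.pos-* a (suc d)) (ℤₚ.pos-* c (suc b)) (+≤+ ad≤cb)) ⟩
    mkℚᵘ (ℤ.+ c) d      ≃⟨ toℚᵘ-// c d ⟨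
    toℚᵘ (c // suc d) ∎)
    where open ℚᵘₚ.≤-Reasoning

  //-cong : ∀ a b c d .{{_ : NonZero b}} .{{_ : NonZero d}} → a ℕ.* d ≡ c ℕ.* b → a // b ≡ c // d
  //-cong a b c d eq = ≤-antisym (//-mono-≤ a b c d (ℕₚ.≤-reflexive eq)) (//-mono-≤ c d a b (ℕₚ.≤-reflexive (sym eq)))

  //-* : ∀ a b c d .{{_ : NonZero b}} .{{_ : NonZero d}} .{{_ : NonZero (b ℕ.* d)}} →
         a // b * c // d ≡ (a ℕ.* c) // (b ℕ.* d)
  //-* a (suc b) c (suc d) = toℚᵘ-injective (begin-equality
    toℚᵘ (a // suc b * c // suc d)             ≃⟨ toℚᵘ-homo-* (a // suc b) (c // suc d) ⟩
    toℚᵘ (a // suc b) ℚᵘ.* toℚᵘ (c // suc d)   ≃⟨ ℚᵘₚ.*-cong (toℚᵘ-// a b) (toℚᵘ-// c d) ⟩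
    mkℚᵘ (ℤ.+ a) b ℚᵘ.* mkℚᵘ (ℤ.+ c) d             ≃⟨ *≡* (cong (ℤ._* ℤ.+ (suc b ℕ.* suc d)) (sym (ℤₚ.pos-* a c))) ⟩
    mkℚᵘ (ℤ.+ (a ℕ.* c)) (d ℕ.+ b ℕ.* suc d)     ≃⟨ toℚᵘ-// (a ℕ.* c) _ ⟨
    toℚᵘ ((a ℕ.* c) // (suc b ℕ.* suc d))      ∎)
    where open ℚᵘₚ.≤-Reasoning

  //-+ : ∀ a b c d .{{_ : NonZero b}} .{{_ : NonZero d}} .{{_ : NonZero (b ℕ.* d)}} →
         a // b + c // d ≡ (a ℕ.* d ℕ.+ c ℕ.* b) // (b ℕ.* d)
  //-+ a (suc b) c (suc d) = toℚᵘ-injective (begin-equality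
    toℚᵘ (a // suc b + c // suc d)             ≃⟨ toℚᵘ-homo-+ (a // suc b) (c // suc d) ⟩
    toℚᵘ (a // suc b) ℚᵘ.+ toℚᵘ (c // suc d)   ≃⟨ ℚᵘₚ.+-cong (toℚᵘ-// a b) (toℚᵘ-// c d) ⟩
    mkℚᵘ (ℤ.+ a) b ℚᵘ.+ mkℚᵘ (ℤ.+ c) d             ≃⟨ *≡* (cong (ℤ._* ℤ.+ (suc b ℕ.* suc d)) (cong₂ ℤ._+_ (sym (ℤₚ.pos-* a (suc d))) (sym (ℤₚ.pos-* c (suc b))))) ⟩
    mkℚᵘ (ℤ.+ (a ℕ.* suc d ℕ.+ c ℕ.* suc b)) (d ℕ.+ b ℕ.* suc d)     ≃⟨ toℚᵘ-// _ _ ⟨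
    toℚᵘ ((a ℕ.* suc d ℕ.+ c ℕ.* suc b) // (suc b ℕ.* suc d))      ∎)
    where open ℚᵘₚ.≤-Reasoning

  -- The hypothesis is the conclusion multiplied by `b * d * m`; the approximations of densities
  -- with error `1/m` are all proved in this form.
  //-≤-+ : ∀ a b c d m .{{_ : NonZero b}} .{{_ : NonZero d}} .{{_ : NonZero m}} →
           a ℕ.* d ℕ.* m ℕ.≤ c ℕ.* b ℕ.* m ℕ.+ b ℕ.* d → a // b ≤ c // d + 1 // m
  //-≤-+ a b c d m le = ≤-trans (//-mono-≤ a b (c ℕ.* m ℕ.+ 1 ℕ.* d) (d ℕ.* m) {{it}} {{ℕₚ.m*n≢0 d m}}
      (subst₂ ℕ._≤_ (ℕₚ.*-assoc a d m) (regroup b c d m) le))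
    (≤-reflexive (sym (//-+ c d 1 m {{it}} {{it}} {{ℕₚ.m*n≢0 d m}})))
    where
    regroup : ∀ b c d m → c ℕ.* b ℕ.* m ℕ.+ b ℕ.* d ≡ (c ℕ.* m ℕ.+ 1 ℕ.* d) ℕ.* b
    regroup = solve-∀

  difference≤ : ∀ p q r → p ≤ q + r → p - q ≤ r
  difference≤ p q r p≤q+r = ≤-trans (+-monoˡ-≤ (- q) p≤q+r) (≤-reflexive (trans (cong (_- q) (+-comm q r))
    (trans (+-assoc r q (- q)) (trans (cong (r +_) (+-inverseʳ q)) (+-identityʳ r)))))

  ∣-∣≤ : ∀ p q r → p ≤ q + r → q ≤ p + r → ∣ p - q ∣ ≤ r
  ∣-∣≤ p q r p≤q+r q≤p+r with ∣p∣≡p∨∣p∣≡-p (p - q)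
  ... | inj₁ eq = subst (_≤ r) (sym eq) (difference≤ p q r p≤q+r)
  ... | inj₂ eq = subst (_≤ r) (sym (trans eq (trans (neg-distrib-+ p (- q))
    (trans (cong (- p +_) (⁻¹-involutive q)) (+-comm (- p) q))))) (difference≤ q p r q≤p+r)

  ∃-half : ∀ ε → 0ℚ < ε → ∃ λ m → Σ (NonZero m) λ m≢0 → (1 // m) {{m≢0}} + (1 // m) {{m≢0}} < ε
  ∃-half (mkℚ (ℤ.+ zero) d _) (*<* (+<+ ()))
  ∃-half (mkℚ ℤ.-[1+ _ ] d _) (*<* ())
  ∃-half ε@(mkℚ (ℤ.+ (suc e)) d _) _ = m , _ , subst (_< ε) (sym (//-+ 1 m 1 m)) (toℚᵘ-cancel-< (begin-strict
    toℚᵘ ((1 ℕ.* m ℕ.+ 1 ℕ.* m) // (m ℕ.* m)) ≃⟨ toℚᵘ-// _ _ ⟩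
    mkℚᵘ (ℤ.+ (1 ℕ.* m ℕ.+ 1 ℕ.* m)) (ℕ.pred (m ℕ.* m)) <⟨ ℚᵘ.*<* (subst₂ ℤ._<_ (ℤₚ.pos-* (1 ℕ.* m ℕ.+ 1 ℕ.* m) (suc d)) (ℤₚ.pos-* (suc e) (m ℕ.* m)) (+<+ small)) ⟩
    toℚᵘ ε ∎))
    where
    open ℚᵘₚ.≤-Reasoning
    -- `ε` is `(e+1)/(d+1)`, so it is at least `1/(d+1)`, while `2/m` is two thirds of that; the
    -- factor 3 instead of 2 makes the inequality strict.
    m = 3 ℕ.* suc d
    small : (1 ℕ.* m ℕ.+ 1 ℕ.* m) ℕ.* suc d ℕ.< suc e ℕ.* (m ℕ.* m)
    small = ℕₚ.<-≤-trans (subst₂ ℕ._<_ (six d) (nine d) (ℕₚ.*-monoˡ-< (suc d ℕ.* suc d) {6} {9} (s≤s (s≤s (s≤s (s≤s (s≤s (s≤s (s≤s z≤n)))))))))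
      (ℕₚ.m≤n*m (m ℕ.* m) (suc e))
      where
      six : ∀ d → 6 ℕ.* ((1 ℕ.+ d) ℕ.* (1 ℕ.+ d)) ≡ (1 ℕ.* (3 ℕ.* (1 ℕ.+ d)) ℕ.+ 1 ℕ.* (3 ℕ.* (1 ℕ.+ d))) ℕ.* (1 ℕ.+ d)
      six = solve-∀
      nine : ∀ d → 9 ℕ.* ((1 ℕ.+ d) ℕ.* (1 ℕ.+ d)) ≡ 3 ℕ.* (1 ℕ.+ d) ℕ.* (3 ℕ.* (1 ℕ.+ d))
      nine = solve-∀

-- Euler products as sieve densities, and convergence.

module Limits where

  open Summation
  open Congruences
  open Sieving
  open Fractions
  open import Data.Nat as ℕ using (ℕ; suc; z≤n; s≤s; NonZero)
  import Data.Nat.Properties as ℕₚ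
  import Data.Nat.DivMod as DivMod
  open import Data.Nat.ListAction using (product)
  open import Data.Nat.Primality using (Prime; prime?; productOfPrimes≢0)
  open import Data.Nat.Tactic.RingSolver using (solve-∀)
  open import Data.Rational as ℚ using (ℚ; 1ℚ)
  import Data.Rational.Properties as ℚₚ
  open import Data.List using (List; []; _∷_; map; filter; foldr; upTo)
  open import Data.List.Membership.Propositional using (_∈_)
  open import Data.List.Membership.Propositional.Properties using (∈-filter⁺; ∈-filter⁻; ∈-upTo⁺; ∈-upTo⁻)
  open import Data.List.Relation.Unary.All using (All; []; _∷_)
  open import Data.List.Relation.Unary.All.Properties using (all-filter)
  open import Data.List.Relation.Unary.Unique.Propositional using (Unique)
  open import Data.List.Relation.Unary.Unique.Propositional.Properties using (filter⁺; upTo⁺)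
  open import Data.Product using (_,_)
  open import Function using (it)
  open import Relation.Nullary using (Dec)
  open import Relation.Binary.PropositionalEquality

  module Arithmetic where
    open import Data.Nat
    open import Data.Nat.Properties

    ^^≡^ : ∀ n s k → (n ^ s) ^ k ≡ n ^ (k * s)
    ^^≡^ n s k = trans (^-*-assoc n s k) (cong (n ^_) (*-comm s k))

    -- Bernoulli's inequality `(1 - r/n)^D ≥ 1 - D r/n` for `n = x + r`, multiplied by `n^(D+1)` and
    -- freed of subtraction.
    bernoulli : ∀ D x r → (x + r) * (x + r) ^ D ≤ (x + r) * x ^ D + D * (r * (x + r) ^ D)
    bernoulli zero    x r = m≤m+n _ _
    bernoulli (suc D) x r = begin
      n * (n * n ^ D)                                       ≤⟨ *-monoʳ-≤ n (bernoulli D x r) ⟩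
      n * (n * x ^ D + D * (r * n ^ D))                     ≡⟨ expand x r (x ^ D) D (n ^ D) ⟩
      n * (x * x ^ D) + r * (n * x ^ D) + D * (r * (n * n ^ D)) ≤⟨ +-monoˡ-≤ _ (+-monoʳ-≤ (n * (x * x ^ D))
                                                                 (*-monoʳ-≤ r (*-monoʳ-≤ n (^-monoˡ-≤ D (m≤m+n x r))))) ⟩
      n * (x * x ^ D) + r * (n * n ^ D) + D * (r * (n * n ^ D)) ≡⟨ +-assoc (n * (x * x ^ D)) _ _ ⟩
      n * x ^ suc D + suc D * (r * n ^ suc D)               ∎
      where
      open ≤-Reasoning
      n = x + r
      expand : ∀ x r u d v → (x + r) * ((x + r) * u + d * (r * v)) ≡ (x + r) * (x * u) + r * ((x + r) * u) + d * (r * ((x + r) * v))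
      expand = solve-∀

    -- For n = x + r with r bounded and n large, x ^ D exhausts n ^ D up to a proportion 1/m.
    ^-remainder : ∀ D m x r q → r ≤ q → D * q * m ≤ x + r → .{{NonZero (x + r)}} → (x + r) ^ D * m ≤ x ^ D * m + (x + r) ^ D
    ^-remainder D m x r q r≤q large = *-cancelˡ-≤ n (begin
      n * (n ^ D * m)                                ≡⟨ *-assoc n (n ^ D) m ⟨
      n * n ^ D * m                                  ≤⟨ *-monoˡ-≤ m (bernoulli D x r) ⟩
      (n * x ^ D + D * (r * n ^ D)) * m              ≡⟨ regroup n (x ^ D) D r (n ^ D) m ⟩
      n * (x ^ D * m) + D * r * m * n ^ D            ≤⟨ +-monoʳ-≤ (n * (x ^ D * m)) (*-monoˡ-≤ (n ^ D)
                                                          (≤-trans (*-monoˡ-≤ m (*-monoʳ-≤ D r≤q)) large)) ⟩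
      n * (x ^ D * m) + n * n ^ D                    ≡⟨ *-distribˡ-+ n _ _ ⟨
      n * (x ^ D * m + n ^ D)                        ∎)
      where
      open ≤-Reasoning
      n = x + r
      regroup : ∀ n u D r v m → (n * u + D * (r * v)) * m ≡ n * (u * m) + D * r * m * v
      regroup = solve-∀

    -- Here `A` of `L` tuples pass in the full cube and `p` of `T` in the trimmed one. Then
    -- `A/L ≤ p/L + (L - T)/L ≤ p/T + 1/m`; adding `T * T * m` to both sides removes the
    -- subtraction.
    excess-bound : ∀ {A p L T} m → A + T ≤ p + L → L * m ≤ T * m + L → T ≤ L → A * T * m ≤ p * L * m + L * T
    excess-bound {A} {p} {L} {T} m growth close T≤L = +-cancelʳ-≤ (T * T * m) _ _ (begin
      A * T * m + T * T * m               ≡⟨ factor A T m ⟩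
      (A + T) * (T * m)                   ≤⟨ *-monoˡ-≤ (T * m) growth ⟩
      (p + L) * (T * m)                   ≡⟨ split p L T m ⟩
      p * T * m + L * m * T               ≤⟨ +-mono-≤ (*-monoˡ-≤ m (*-monoʳ-≤ p T≤L)) (*-monoˡ-≤ T close) ⟩
      p * L * m + (T * m + L) * T         ≡⟨ regroup (p * L * m) L T m ⟩
      p * L * m + L * T + T * T * m       ∎)
      where
      open ≤-Reasoning
      factor : ∀ A T m → A * T * m + T * T * m ≡ (A + T) * (T * m)
      factor = solve-∀
      split : ∀ p L T m → (p + L) * (T * m) ≡ p * T * m + L * m * T
      split = solve-∀
      regroup : ∀ u L T m → u + (T * m + L) * T ≡ u + L * T + T * T * m
      regroup = solve-∀

    -- The reverse comparison: `p/T` exceeds `p/L` by `(p/T)(L - T)/L`, which is at most `1/m` since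
    -- `p ≤ T`, and `p/L ≤ A/L`.
    deficit-bound : ∀ {A p L T} m → p ≤ A → p ≤ T → L * m ≤ T * m + L → p * L * m ≤ A * T * m + T * L
    deficit-bound {A} {p} {L} {T} m p≤A p≤T close = begin
      p * L * m              ≡⟨ *-assoc p L m ⟩
      p * (L * m)            ≤⟨ *-monoʳ-≤ p close ⟩
      p * (T * m + L)        ≡⟨ split p L T m ⟩
      p * T * m + p * L      ≤⟨ +-mono-≤ (*-monoˡ-≤ m (*-monoˡ-≤ T p≤A)) (*-monoˡ-≤ L p≤T) ⟩
      A * T * m + T * L      ∎
      where
      open ≤-Reasoning
      split : ∀ p L T m → p * (T * m + L) ≡ p * T * m + p * L
      split = solve-∀

    -- The shape of //-≤-+ for fractions over a common denominator.
    common-denominator : ∀ {a v L} m → m * a ≤ m * v + L → a * L * m ≤ v * L * m + L * L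
    common-denominator {a} {v} {L} m le = subst₂ _≤_ (rearrange a L m) (distribute v L m) (*-monoˡ-≤ L le)
      where
      rearrange : ∀ a L m → m * a * L ≡ a * L * m
      rearrange = solve-∀
      distribute : ∀ v L m → (m * v + L) * L ≡ v * L * m + L * L
      distribute = solve-∀

  primesUpTo : ℕ → List ℕ
  primesUpTo M = filter prime? (upTo (suc M))

  primesUpTo-prime : ∀ M → All Prime (primesUpTo M)
  primesUpTo-prime M = all-filter prime? (upTo (suc M))

  primesUpTo-unique : ∀ M → Unique (primesUpTo M)
  primesUpTo-unique M = filter⁺ prime? (upTo⁺ (suc M))

  primesUpTo-complete : ∀ M p → Prime p → p ℕ.≤ M → p ∈ primesUpTo M
  primesUpTo-complete M p p-prime p≤M = ∈-filter⁺ prime? (∈-upTo⁺ (s≤s p≤M)) p-prime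

  primesUpTo-mono : ∀ {M M′} → M ℕ.≤ M′ → ∀ {p} → p ∈ primesUpTo M → p ∈ primesUpTo M′
  primesUpTo-mono {M} {M′} M≤M′ {p} p∈ = let p∈upTo , p-prime = ∈-filter⁻ prime? p∈ in
    primesUpTo-complete M′ p p-prime (ℕₚ.≤-trans (ℕ.s≤s⁻¹ (∈-upTo⁻ p∈upTo)) M≤M′)

  primorial : ℕ → ℕ
  primorial M = product (primesUpTo M)

  primorial≢0 : ∀ M → NonZero (primorial M)
  primorial≢0 M = productOfPrimes≢0 (primesUpTo-prime M)

  module Euler {k : ℕ} (H : Graph k) (s : ℕ) where
    open Sieve H s

    D : ℕ
    D = k ℕ.* s

    foldr-eulerFactor : ∀ {ps} → All Prime ps → (Q≢0 : NonZero (product ps ℕ.^ D)) →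
      foldr ℚ._*_ 1ℚ (map (eulerFactor H s) ps) ≡ (chromatics ps // (product ps ℕ.^ D)) {{Q≢0}}
    foldr-eulerFactor [] Q≢0 = //-cong 1 1 1 (1 ℕ.^ D) {{it}} {{Q≢0}} (cong (ℕ._+ 0) (ℕₚ.^-zeroˡ D))
    -- Primes are nonzero, so `eulerFactor` is never taken at its default value at zero.
    foldr-eulerFactor {suc p ∷ ps} (p-prime ∷ primes) Q≢0 = begin
      eulerFactor H s (suc p) ℚ.* foldr ℚ._*_ 1ℚ (map (eulerFactor H s) ps)
        ≡⟨ cong (eulerFactor H s (suc p) ℚ.*_) (foldr-eulerFactor primes Q′≢0) ⟩
      c // P ℚ.* chromatics ps // Q
        ≡⟨ //-* c P (chromatics ps) Q ⟩
      (c ℕ.* chromatics ps) // (P ℕ.* Q)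
        ≡⟨ //-cong (c ℕ.* chromatics ps) (P ℕ.* Q) (c ℕ.* chromatics ps) _ {{it}} {{Q≢0}}
             (cong (c ℕ.* chromatics ps ℕ.*_) (^-distribʳ-* D (suc p) (product ps))) ⟩
      ((c ℕ.* chromatics ps) // (product (suc p ∷ ps) ℕ.^ D)) {{Q≢0}} ∎
      where
      open ≡-Reasoning
      c = chromatic H (suc p ℕ.^ s)
      P = suc p ℕ.^ D
      Q = product ps ℕ.^ D
      instance
        P≢0 : NonZero P
        P≢0 = ℕₚ.m^n≢0 (suc p) D
        Q′≢0 : NonZero Q
        Q′≢0 = ℕₚ.m^n≢0 (product ps) D {{productOfPrimes≢0 primes}}
        PQ≢0 : NonZero (P ℕ.* Q)
        PQ≢0 = ℕₚ.m*n≢0 P Q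

    density : (a n : ℕ) .{{_ : NonZero n}} → ℚ
    density a n = (a // (n ℕ.^ D)) {{ℕₚ.m^n≢0 n D}}

    -- The free multiplier `t` allows the same product to be read off in a trimmed cube and in a
    -- common multiple of two primorials.
    partialProduct≡density : ∀ M t .{{_ : NonZero (t ℕ.* primorial M)}} →
      partialProduct H s M ≡ density (sieve (primesUpTo M) (t ℕ.* primorial M)) (t ℕ.* primorial M)
    partialProduct≡density M t = trans (foldr-eulerFactor (primesUpTo-prime M) (ℕₚ.m^n≢0 Q D {{primorial≢0 M}}))
      (//-cong c (Q ℕ.^ D) (sieve ps (t ℕ.* Q)) ((t ℕ.* Q) ℕ.^ D) {{ℕₚ.m^n≢0 Q D {{primorial≢0 M}}}} {{ℕₚ.m^n≢0 (t ℕ.* Q) D}} (begin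
        c ℕ.* (t ℕ.* Q) ℕ.^ D                ≡⟨ cong (c ℕ.*_) (^-distribʳ-* D t Q) ⟩
        c ℕ.* (t ℕ.^ D ℕ.* Q ℕ.^ D)          ≡⟨ rearrange c (t ℕ.^ D) (Q ℕ.^ D) ⟩
        t ℕ.^ D ℕ.* c ℕ.* Q ℕ.^ D            ≡⟨ cong (λ e → e ℕ.* c ℕ.* Q ℕ.^ D) (Arithmetic.^^≡^ t s k) ⟨
        (t ℕ.^ s) ℕ.^ k ℕ.* c ℕ.* Q ℕ.^ D    ≡⟨ cong (ℕ._* Q ℕ.^ D) (sieve-multiple (primesUpTo-prime M) (primesUpTo-unique M) t) ⟨
        sieve ps (t ℕ.* Q) ℕ.* Q ℕ.^ D       ∎))
      where
      open ≡-Reasoning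
      ps = primesUpTo M
      Q = primorial M
      c = chromatics ps
      rearrange : ∀ c u v → c ℕ.* (u ℕ.* v) ≡ u ℕ.* c ℕ.* v
      rearrange = solve-∀

    density-mono : ∀ {a b} n .{{_ : NonZero n}} → a ℕ.≤ b → density a n ℚ.≤ density b n
    density-mono {a} {b} n a≤b = //-mono-≤ a (n ℕ.^ D) b (n ℕ.^ D) {{ℕₚ.m^n≢0 n D}} {{ℕₚ.m^n≢0 n D}} (ℕₚ.*-monoˡ-≤ (n ℕ.^ D) a≤b)

    density-≤-+ : ∀ a x b y m .{{_ : NonZero x}} .{{_ : NonZero y}} .{{_ : NonZero m}} →
      a ℕ.* y ℕ.^ D ℕ.* m ℕ.≤ b ℕ.* x ℕ.^ D ℕ.* m ℕ.+ x ℕ.^ D ℕ.* y ℕ.^ D → density a x ℚ.≤ density b y ℚ.+ 1 // m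
    density-≤-+ a x b y m = //-≤-+ a (x ℕ.^ D) b (y ℕ.^ D) m {{ℕₚ.m^n≢0 x D}} {{ℕₚ.m^n≢0 y D}}

    module Convergence (2≤s : 2 ℕ.≤ s) (2≤k : 2 ℕ.≤ k) (dec : (X Y : Point s) → Dec (X ◇ Y)) (m : ℕ) .{{m≢0 : NonZero m}} where
      open Visibility dec

      -- `C` collects the `k²` pairs and the factor `2 ^ s` of the tail bound, so that the tail
      -- beyond `M₀ = C * m` has proportion `1/m`. In `N₀`, the summand `suc M₀` puts the side above
      -- the cutoff, `Q₀` leaves room for a full period, and `D * Q₀ * m` makes the trimmed
      -- remainder negligible.
      C M₀ Q₀ N₀ : ℕ
      C = k ℕ.* (k ℕ.* 2 ℕ.^ s)
      M₀ = C ℕ.* m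
      Q₀ = primorial M₀
      N₀ = suc M₀ ℕ.+ (Q₀ ℕ.+ D ℕ.* Q₀ ℕ.* m)

      instance
        Q₀≢0 : NonZero Q₀
        Q₀≢0 = primorial≢0 M₀
        C≢0 : NonZero C
        C≢0 = ℕₚ.m*n≢0 k _ {{k≢0}} {{ℕₚ.m*n≢0 k _ {{k≢0}} {{ℕₚ.m^n≢0 2 s}}}}
          where
          k≢0 : NonZero k
          k≢0 = ℕ.>-nonZero (ℕₚ.≤-trans (s≤s z≤n) 2≤k)

      sieve₀ : ℕ → ℕ
      sieve₀ = sieve (primesUpTo M₀)

      sieve₀-tail : ∀ {n} → M₀ ℕ.< n → m ℕ.* sieve₀ n ℕ.≤ m ℕ.* visibles n ℕ.+ n ℕ.^ D
      sieve₀-tail {n} M₀<n = ℕₚ.*-cancelˡ-≤ C (begin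
        C ℕ.* (m ℕ.* sieve₀ n)                          ≡⟨ ℕₚ.*-assoc C m _ ⟨
        M₀ ℕ.* sieve₀ n                                 ≤⟨ sieve-tail 2≤s M₀<n (primesUpTo-complete M₀) ⟩
        M₀ ℕ.* visibles n ℕ.+ k ℕ.* (k ℕ.* (2 ℕ.^ s ℕ.* (n ℕ.^ s) ℕ.^ k))
          ≡⟨ cong (λ L → M₀ ℕ.* visibles n ℕ.+ k ℕ.* (k ℕ.* (2 ℕ.^ s ℕ.* L))) (Arithmetic.^^≡^ n s k) ⟩
        M₀ ℕ.* visibles n ℕ.+ k ℕ.* (k ℕ.* (2 ℕ.^ s ℕ.* n ℕ.^ D))
          ≡⟨ regroup k (2 ℕ.^ s) m (visibles n) (n ℕ.^ D) ⟩
        C ℕ.* (m ℕ.* visibles n ℕ.+ n ℕ.^ D)            ∎)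
        where
        open ℕₚ.≤-Reasoning
        regroup : ∀ k a m v l → k ℕ.* (k ℕ.* a) ℕ.* m ℕ.* v ℕ.+ k ℕ.* (k ℕ.* (a ℕ.* l)) ≡ k ℕ.* (k ℕ.* a) ℕ.* (m ℕ.* v ℕ.+ l)
        regroup = solve-∀

      module _ (n : ℕ) (N₀≤n : N₀ ℕ.≤ n) where
        -- `visibleProb` at `n` refers to the cube of side `n + 1`, which is `N`; `N₁` is the
        -- largest multiple of `Q₀` not above it.
        N t r N₁ : ℕ
        N = suc n
        t = N DivMod./ Q₀
        r = N DivMod.% Q₀
        N₁ = t ℕ.* Q₀

        N₀≤N : N₀ ℕ.≤ N
        N₀≤N = ℕₚ.m≤n⇒m≤1+n N₀≤n

        N₁+r≡N : N₁ ℕ.+ r ≡ N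
        N₁+r≡N = trans (ℕₚ.+-comm N₁ r) (sym (DivMod.m≡m%n+[m/n]*n N Q₀))

        N₁≤N : N₁ ℕ.≤ N
        N₁≤N = DivMod.m/n*n≤m N Q₀

        instance
          N₁≢0 : NonZero N₁
          N₁≢0 = ℕₚ.m*n≢0 t Q₀ {{ℕ.>-nonZero (DivMod.m≥n⇒m/n>0 (ℕₚ.≤-trans (ℕₚ.m≤m+n Q₀ _) (ℕₚ.≤-trans (ℕₚ.m≤n+m _ (suc M₀)) N₀≤N)))}}

        N₁-close : N ℕ.^ D ℕ.* m ℕ.≤ N₁ ℕ.^ D ℕ.* m ℕ.+ N ℕ.^ D
        N₁-close = subst (λ N → N ℕ.^ D ℕ.* m ℕ.≤ N₁ ℕ.^ D ℕ.* m ℕ.+ N ℕ.^ D) N₁+r≡N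
          (Arithmetic.^-remainder D m N₁ r Q₀ (DivMod.m%n≤n N Q₀)
            (subst (D ℕ.* Q₀ ℕ.* m ℕ.≤_) (sym N₁+r≡N)
              (ℕₚ.≤-trans (ℕₚ.m≤n+m _ Q₀) (ℕₚ.≤-trans (ℕₚ.m≤n+m _ (suc M₀)) N₀≤N)))
            {{subst NonZero (sym N₁+r≡N) it}})

        visibleProb≡density : visibleProb dec H n ≡ density (visibles N) N
        visibleProb≡density = cong (λ v → density v N) (visibleCount≡visibles N)

        visible≤sieve : visibleProb dec H n ℚ.≤ density (sieve₀ N) N
        visible≤sieve = subst (ℚ._≤ density (sieve₀ N) N) (sym visibleProb≡density)
          (density-mono N (visibles≤sieve (primesUpTo-prime M₀) N))

        sieve≤visible : density (sieve₀ N) N ℚ.≤ visibleProb dec H n ℚ.+ 1 // m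
        sieve≤visible = subst (λ v → density (sieve₀ N) N ℚ.≤ v ℚ.+ 1 // m) (sym visibleProb≡density)
          (density-≤-+ (sieve₀ N) N (visibles N) N m (Arithmetic.common-denominator m
            (sieve₀-tail (ℕₚ.≤-trans (ℕₚ.m≤m+n (suc M₀) _) N₀≤N))))

        sieve≤product : density (sieve₀ N) N ℚ.≤ partialProduct H s M₀ ℚ.+ 1 // m
        sieve≤product = subst (λ P → density (sieve₀ N) N ℚ.≤ P ℚ.+ 1 // m) (sym (partialProduct≡density M₀ t))
          (density-≤-+ (sieve₀ N) N (sieve₀ N₁) N₁ m (Arithmetic.excess-bound m
            (subst₂ (λ T L → sieve₀ N ℕ.+ T ℕ.≤ sieve₀ N₁ ℕ.+ L) (Arithmetic.^^≡^ N₁ s k) (Arithmetic.^^≡^ N s k) (sieve-growth (primesUpTo M₀) N₁≤N))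
            N₁-close (ℕₚ.^-monoˡ-≤ D N₁≤N)))

        product≤sieve : partialProduct H s M₀ ℚ.≤ density (sieve₀ N) N ℚ.+ 1 // m
        product≤sieve = subst (ℚ._≤ density (sieve₀ N) N ℚ.+ 1 // m) (sym (partialProduct≡density M₀ t))
          (density-≤-+ (sieve₀ N₁) N₁ (sieve₀ N) N m (Arithmetic.deficit-bound m
            (sieve-mono (primesUpTo M₀) N₁≤N)
            (subst (sieve₀ N₁ ℕ.≤_) (Arithmetic.^^≡^ N₁ s k) (sieve≤ (primesUpTo M₀) N₁))
            N₁-close))

      module _ (M : ℕ) (M₀≤M : M₀ ℕ.≤ M) where
        -- A common multiple of both primorials; the factor `suc M₀` lifts it above `M₀`, as
        -- `sieve₀-tail` requires.
        Q N₂ : ℕ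
        Q = primorial M
        N₂ = Q ℕ.* suc M₀ ℕ.* Q₀

        N₂≡ : N₂ ≡ suc M₀ ℕ.* Q₀ ℕ.* Q
        N₂≡ = rotate Q (suc M₀) Q₀
          where
          rotate : ∀ a b c → a ℕ.* b ℕ.* c ≡ b ℕ.* c ℕ.* a
          rotate = solve-∀

        instance
          Q≢0 : NonZero Q
          Q≢0 = primorial≢0 M
          N₂≢0 : NonZero N₂
          N₂≢0 = ℕₚ.m*n≢0 (Q ℕ.* suc M₀) Q₀ {{ℕₚ.m*n≢0 Q (suc M₀)}}

        M₀<N₂ : M₀ ℕ.< N₂
        M₀<N₂ = ℕₚ.≤-trans (ℕₚ.m≤n*m (suc M₀) Q) (ℕₚ.m≤m*n (Q ℕ.* suc M₀) Q₀)

        product₀≡density : partialProduct H s M₀ ≡ density (sieve₀ N₂) N₂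
        product₀≡density = partialProduct≡density M₀ (Q ℕ.* suc M₀)

        product≡density : partialProduct H s M ≡ density (sieve (primesUpTo M) N₂) N₂
        -- With the side a variable, matching on `refl` also settles its nonzero instance.
        product≡density = via N₂ (sym N₂≡)
          where
          via : ∀ N .{{_ : NonZero N}} → suc M₀ ℕ.* Q₀ ℕ.* Q ≡ N → partialProduct H s M ≡ density (sieve (primesUpTo M) N) N
          via N refl = partialProduct≡density M (suc M₀ ℕ.* Q₀)

        product-antimono : partialProduct H s M ℚ.≤ partialProduct H s M₀
        product-antimono = subst₂ ℚ._≤_ (sym product≡density) (sym product₀≡density)
          (density-mono N₂ (sieve-antimono (primesUpTo-mono M₀≤M) N₂))

        -- Visible tuples mediate: the sieve up to `M₀` exceeds their number by at most a proportion
        -- `1/m`, and they pass the sieve up to any `M`. No separate estimate of Euler factors is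
        -- made.
        product-tail : partialProduct H s M₀ ℚ.≤ partialProduct H s M ℚ.+ 1 // m
        product-tail = subst₂ (λ P₀ P → P₀ ℚ.≤ P ℚ.+ 1 // m) (sym product₀≡density) (sym product≡density)
          (density-≤-+ (sieve₀ N₂) N₂ (sieve (primesUpTo M) N₂) N₂ m (Arithmetic.common-denominator m
            (ℕₚ.≤-trans (sieve₀-tail M₀<N₂) (ℕₚ.+-monoˡ-≤ (N₂ ℕ.^ D) (ℕₚ.*-monoʳ-≤ m (visibles≤sieve (primesUpTo-prime M) N₂))))))

      -- Each of the two chains has one monotone step at no cost and two comparisons costing `1/m`,
      -- which is why `m` is chosen with `2/m < ε`.
      probability-close : ∀ n M → N₀ ℕ.≤ n → N₀ ℕ.≤ M → ℚ.∣ visibleProb dec H n ℚ.- partialProduct H s M ∣ ℚ.≤ 1 // m ℚ.+ 1 // m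
      probability-close n M N₀≤n N₀≤M = ∣-∣≤ v P (η ℚ.+ η)
        (begin
          v                             ≤⟨ visible≤sieve n N₀≤n ⟩
          a                             ≤⟨ sieve≤product n N₀≤n ⟩
          P₀ ℚ.+ η                      ≤⟨ ℚₚ.+-monoˡ-≤ η (product-tail M M₀≤M) ⟩
          P ℚ.+ η ℚ.+ η                 ≡⟨ ℚₚ.+-assoc P η η ⟩
          P ℚ.+ (η ℚ.+ η)               ∎)
        (begin
          P                             ≤⟨ product-antimono M M₀≤M ⟩
          P₀                            ≤⟨ product≤sieve n N₀≤n ⟩
          a ℚ.+ η                       ≤⟨ ℚₚ.+-monoˡ-≤ η (sieve≤visible n N₀≤n) ⟩
          v ℚ.+ η ℚ.+ η                 ≡⟨ ℚₚ.+-assoc v η η ⟩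
          v ℚ.+ (η ℚ.+ η)               ∎)
        where
        open ℚₚ.≤-Reasoning
        η = 1 // m
        v = visibleProb dec H n
        P = partialProduct H s M
        P₀ = partialProduct H s M₀
        a = density (sieve₀ (suc n)) (suc n)
        M₀≤M : M₀ ℕ.≤ M
        M₀≤M = ℕₚ.≤-trans (ℕₚ.n≤1+n M₀) (ℕₚ.≤-trans (ℕₚ.m≤m+n (suc M₀) _) N₀≤M)

open import Data.Nat using (ℕ; _≤_)
open import Data.Integer using (ℤ)
open import Data.Rational using (ℚ; _<_; _-_; ∣_∣; 0ℚ)
open import Data.Rational.Properties using (≤-<-trans)
open import Data.Product using (Σ; _,_)
open import Relation.Nullary using (Dec)

theorem2 : (s k : ℕ) → 2 ≤ s → 2 ≤ k → (H : Graph k)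
    → (dec : (X Y : Point s) → Dec (X ◇ Y))
    → (ε : ℚ) → 0ℚ < ε
    → Σ ℕ (λ N → (n M : ℕ) → N ≤ n → N ≤ M
    → ∣ visibleProb dec H n - partialProduct H s M ∣ < ε)
theorem2 s k 2≤s 2≤k H dec ε 0<ε =
  let m , m≢0 , η+η<ε = Fractions.∃-half ε 0<ε
      open Limits.Euler.Convergence H s 2≤s 2≤k dec m {{m≢0}} using (N₀; probability-close)
  in N₀ , λ n M N₀≤n N₀≤M → ≤-<-trans (probability-close n M N₀≤n N₀≤M) η+η<ε
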